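{- If $P$ is a closed AL$\pi$ process, then $[\![P]\!]_\emptyset\simeq P$, where $\simeq$ is weak similarity equivalence (weak similarity in both directions).
   Context: AL$\pi$ (simply-typed Asynchronous Localised $\pi$-calculus): processes $P::=0\mid P\mid Q\mid a(x).P\mid\overline{b}\langle c\rangle\mid(\nu a)P\mid\ !a(x).P$ with the standard asynchronous $\pi$-calculus LTS, subject to the constraint that only output capabilities are communicated: in $a(x).P$ and $!a(x).P$ the received name $x$ never occurs free in $P$ as the subject of an input. Value types are $T::=o\,T\mid\mathsf{unit}$, restricted names having a type allowing both input and output. AW$\pi$: besides success names (O-names carrying only $\star$, never restricted), each name is an I-name (only input subject) or an O-name (only output subject); processes $P ::= 0 \mid P \mid Q \mid a(x).P \mid \overline{b}\langle \tilde v\rangle \mid (\nu\, a \leftrightarrow b)P \mid\ !a(x).P$ (polyadic communication allowed), where $(\nu\,a\leftrightarrow b)$ connects I-name $a$ with O-name $b$; its reduction semantics: $(\nu\,a\leftrightarrow b)(a(\tilde x).P\mid\overline{b}\langle\tilde v\rangle\mid Q)\to(\nu\,a\leftrightarrow b)(P\{\tilde v/\tilde x\}\mid Q)$, analogously for persistent $!a(\tilde x).P$, closed under parallel composition, restriction and structural congruence. Encoding $[\![\cdot]\!]_f$ from AL$\pi$ to AW$\pi$, parametrised by a finite map $f$ on names, each AL$\pi$ name being treated as an O-name of AW$\pi$: $[\![(\nu a)P]\!]_f=(\nu\,\hat a\leftrightarrow a)(\nu\,\hat b\leftrightarrow b)(\nu\,\hat c\leftrightarrow c)\big([\![P]\!]_{f[a\mapsto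 b]}\mid\overline{c}\langle\hat a,\hat b\rangle\mid\ !\hat c(a',b').a'(x).b'(y).(\overline{c}\langle a',b'\rangle\mid\overline{y}\langle x\rangle)\big)$, with $\hat a,\hat b,\hat c$ fresh I-names and $b,c$ fresh O-names; $[\![a(y).P]\!]_f=(\nu\,z\leftrightarrow z')\big(\overline{f(a)}\langle z'\rangle\mid z(y).[\![P]\!]_f\big)$ with $z,z'$ fresh; $[\![!a(y).P]\!]_f=(\nu\,d\leftrightarrow d')\big(\overline{d'}\langle\star\rangle\mid\ !d(u).(\overline{d'}\langle\star\rangle\mid[\![a(y).P]\!]_f)\big)$ with $d,d'$ fresh; $[\![\overline{a}\langle b\rangle]\!]_f=\overline{a}\langle b\rangle$; $[\![P\mid Q]\!]_f=[\![P]\!]_f\mid[\![Q]\!]_f$; $[\![0]\!]_f=0$. A closed process has only success names free (success names are not changed by the encoding). On closed processes of both calculi the observable actions are $\tau$ (a reduction) and outputs $\overline{\omega}\langle\star\rangle$ at success names; a weak simulation is a relation $\mathcal{S}$ such that $P\,\mathcal{S}\,Q$ and $P\xrightarrow{\mu}P'$ imply $Q\Rightarrow\xrightarrow{\mu}\Rightarrow Q'$ (just $Q\Rightarrow Q'$ if $\mu=\tau$) with $P'\,\mathcal{S}\,Q'$; $P\simeq Q$ iff each is weakly simulated by the other. -}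

module Defs where

open import Data.Nat using (ℕ; zero; suc; _+_)
open import Data.Fin using (Fin; zero; suc; splitAt; _↑ˡ_; _↑ʳ_; #_)
open import Data.Vec using (Vec; []; _∷_; lookup; map)
open import Data.Sum using (_⊎_; inj₁; inj₂)
open import Data.Product using (Σ; _×_; _,_; ∃)
open import Relation.Binary.PropositionalEquality using (_≡_)
open import Relation.Binary.Construct.Closure.ReflexiveTransitive using (Star)

-- Names are de Bruijn indices (α-conversion is built in); success
-- names are global constants indexed by ℕ, never bound.

data Val (n : ℕ) : Set where
  var : Fin n → Val n
  sn  : ℕ → Val n
  ⋆   : Val n

data Proc (n : ℕ) : Set where
  nil : Proc n
  par : Proc n → Proc n → Proc n
  inp : Val n → Proc (suc n) → Proc n
  rep : Val n → Proc (suc n) → Proc n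
  out : Val n → Val n → Proc n
  nu  : Proc (suc n) → Proc n

Sub : ℕ → ℕ → Set
Sub n m = Fin n → Val m

wkV : ∀ {n} → Val n → Val (suc n)
wkV (var i) = var (suc i)
wkV (sn w)  = sn w
wkV ⋆       = ⋆

exts : ∀ {n m} → Sub n m → Sub (suc n) (suc m)
exts σ zero    = var zero
exts σ (suc i) = wkV (σ i)

subV : ∀ {n m} → Sub n m → Val n → Val m
subV σ (var i) = σ i
subV σ (sn w)  = sn w
subV σ ⋆       = ⋆

sub : ∀ {n m} → Sub n m → Proc n → Proc m
sub σ nil       = nil
sub σ (par P Q) = par (sub σ P) (sub σ Q)
sub σ (inp a P) = inp (subV σ a) (sub (exts σ) P)
sub σ (rep a P) = rep (subV σ a) (sub (exts σ) P)
sub σ (out a c) = out (subV σ a) (subV σ c)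
sub σ (nu P)    = nu (sub (exts σ) P)

wk : ∀ {n} → Proc n → Proc (suc n)
wk = sub (λ i → var (suc i))

swapSub : ∀ {n} → Sub (suc (suc n)) (suc (suc n))
swapSub zero          = var (suc zero)
swapSub (suc zero)    = var zero
swapSub (suc (suc i)) = var (suc (suc i))

swap : ∀ {n} → Proc (suc (suc n)) → Proc (suc (suc n))
swap = sub swapSub

sub1 : ∀ {n} → Proc (suc n) → Val n → Proc n
sub1 {n} P c = sub σ P
  where
  σ : Sub (suc n) n
  σ zero    = c
  σ (suc i) = var i

-- ALπ : the standard (late, de Bruijn) LTS of the asynchronous π-calculus

data Act (n : ℕ) : Set where
  τ     : Act n
  inpA  : Val n → Act n
  outA  : Val n → Val n → Act n
  boutA : Val n → Act n

tgt : ∀ {n} → Act n → ℕ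
tgt {n} τ          = n
tgt {n} (inpA a)   = suc n
tgt {n} (outA a c) = n
tgt {n} (boutA a)  = suc n

liftA : ∀ {n} (α : Act n) → Proc n → Proc (tgt α)
liftA τ          P = P
liftA (inpA a)   P = wk P
liftA (outA a c) P = P
liftA (boutA a)  P = wk P

wkA : ∀ {n} → Act n → Act (suc n)
wkA τ          = τ
wkA (inpA a)   = inpA (wkV a)
wkA (outA a c) = outA (wkV a) (wkV c)
wkA (boutA a)  = boutA (wkV a)

resAdj : ∀ {n} (α : Act n) → Proc (tgt (wkA α)) → Proc (suc (tgt α))
resAdj τ          P = P
resAdj (inpA a)   P = swap P
resAdj (outA a c) P = P
resAdj (boutA a)  P = swap P

data Step : ∀ {n} → Proc n → (α : Act n) → Proc (tgt α) → Set where
  inp-ax  : ∀ {n} {a : Val n} {P} → Step (inp a P) (inpA a) P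
  rep-ax  : ∀ {n} {a : Val n} {P} → Step (rep a P) (inpA a) (par P (wk (rep a P)))
  out-ax  : ∀ {n} {a c : Val n} → Step (out a c) (outA a c) nil
  par-l   : ∀ {n} {P Q : Proc n} {α P'} → Step P α P' → Step (par P Q) α (par P' (liftA α Q))
  par-r   : ∀ {n} {P Q : Proc n} {α Q'} → Step Q α Q' → Step (par P Q) α (par (liftA α P) Q')
  comm-l  : ∀ {n} {P Q : Proc n} {a c P' Q'} →
            Step P (outA a c) P' → Step Q (inpA a) Q' → Step (par P Q) τ (par P' (sub1 Q' c))
  comm-r  : ∀ {n} {P Q : Proc n} {a c P' Q'} →
            Step P (inpA a) P' → Step Q (outA a c) Q' → Step (par P Q) τ (par (sub1 P' c) Q')
  close-l : ∀ {n} {P Q : Proc n} {a P' Q'} →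
            Step P (boutA a) P' → Step Q (inpA a) Q' → Step (par P Q) τ (nu (par P' Q'))
  close-r : ∀ {n} {P Q : Proc n} {a P' Q'} →
            Step P (inpA a) P' → Step Q (boutA a) Q' → Step (par P Q) τ (nu (par P' Q'))
  res     : ∀ {n} {P : Proc (suc n)} {α : Act n} {P'} →
            Step P (wkA α) P' → Step (nu P) α (nu (resAdj α P'))
  opn     : ∀ {n} {P : Proc (suc n)} {a : Val n} {P'} →
            Step P (outA (wkV a) (var zero)) P' → Step (nu P) (boutA a) P'

-- ALπ : simple types with localisation (only output capabilities
-- are communicated; only restricted names are input subjects)

data VTy : Set where
  unit : VTy
  o    : VTy → VTy

data CTy : Set where
  rcv  : VTy → CTy   -- bound by an input: value type T
  chan : VTy → CTy   -- bound by a restriction: input+output capability, carrying T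

Ctx : ℕ → Set
Ctx n = Vec CTy n

data _⊢v_∶_ {n : ℕ} (Γ : Ctx n) : Val n → VTy → Set where
  t⋆    : Γ ⊢v ⋆ ∶ unit
  tsn   : ∀ {w} → Γ ⊢v sn w ∶ o unit
  trcv  : ∀ {i T} → lookup Γ i ≡ rcv T → Γ ⊢v var i ∶ T
  tchan : ∀ {i T} → lookup Γ i ≡ chan T → Γ ⊢v var i ∶ o T

data _⊢_ : ∀ {n} → Ctx n → Proc n → Set where
  tnil : ∀ {n} {Γ : Ctx n} → Γ ⊢ nil
  tpar : ∀ {n} {Γ : Ctx n} {P Q} → Γ ⊢ P → Γ ⊢ Q → Γ ⊢ par P Q
  tout : ∀ {n} {Γ : Ctx n} {a c T} → Γ ⊢v a ∶ o T → Γ ⊢v c ∶ T → Γ ⊢ out a c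
  tinp : ∀ {n} {Γ : Ctx n} {i T P} → lookup Γ i ≡ chan T → (rcv T ∷ Γ) ⊢ P → Γ ⊢ inp (var i) P
  trep : ∀ {n} {Γ : Ctx n} {i T P} → lookup Γ i ≡ chan T → (rcv T ∷ Γ) ⊢ P → Γ ⊢ rep (var i) P
  tnu  : ∀ {n} {Γ : Ctx n} {T P} → (chan T ∷ Γ) ⊢ P → Γ ⊢ nu P

data WVal (n : ℕ) : Set where
  wvar : Fin n → WVal n
  wsn  : ℕ → WVal n
  w⋆   : WVal n

data WProc (n : ℕ) : Set where
  wnil : WProc n
  wpar : WProc n → WProc n → WProc n
  -- a(x₁…x_k).P : x_{j+1} is var j (j < k) inside P
  winp : WVal n → (k : ℕ) → WProc (k + n) → WProc n
  wrep : WVal n → (k : ℕ) → WProc (k + n) → WProc n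
  wout : ∀ {k} → WVal n → Vec (WVal n) k → WProc n
  -- (ν a↔b)P : a (I-name) is var 0, b (O-name) is var 1 inside P
  wnu  : WProc (2 + n) → WProc n

WSub : ℕ → ℕ → Set
WSub n m = Fin n → WVal m

wwkV : ∀ {m} (k : ℕ) → WVal m → WVal (k + m)
wwkV k (wvar i) = wvar (k ↑ʳ i)
wwkV k (wsn w)  = wsn w
wwkV k w⋆       = w⋆

wexts : ∀ {n m} (k : ℕ) → WSub n m → WSub (k + n) (k + m)
wexts {n} {m} k σ i with splitAt k i
... | inj₁ j = wvar (j ↑ˡ m)
... | inj₂ j = wwkV k (σ j)

wsubV : ∀ {n m} → WSub n m → WVal n → WVal m
wsubV σ (wvar i) = σ i
wsubV σ (wsn w)  = wsn w
wsubV σ w⋆       = w⋆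

wsub : ∀ {n m} → WSub n m → WProc n → WProc m
wsub σ wnil         = wnil
wsub σ (wpar P Q)   = wpar (wsub σ P) (wsub σ Q)
wsub σ (winp a k P) = winp (wsubV σ a) k (wsub (wexts k σ) P)
wsub σ (wrep a k P) = wrep (wsubV σ a) k (wsub (wexts k σ) P)
wsub σ (wout a vs)  = wout (wsubV σ a) (map (wsubV σ) vs)
wsub σ (wnu P)      = wnu (wsub (wexts 2 σ) P)

wwk : ∀ {n} (k : ℕ) → WProc n → WProc (k + n)
wwk k = wsub (λ i → wvar (k ↑ʳ i))

winst : ∀ {n k} → Vec (WVal n) k → WProc (k + n) → WProc n
winst {n} {k} vs P = wsub σ P
  where
  σ : WSub (k + n) n
  σ i with splitAt k i
  ... | inj₁ j = lookup vs j
  ... | inj₂ j = wvar j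

swap4 : ∀ {n} → WSub (suc (suc (suc (suc n)))) (suc (suc (suc (suc n))))
swap4 zero                      = wvar (# 2)
swap4 (suc zero)                = wvar (# 3)
swap4 (suc (suc zero))          = wvar (# 0)
swap4 (suc (suc (suc zero)))    = wvar (# 1)
swap4 (suc (suc (suc (suc i)))) = wvar (suc (suc (suc (suc i))))

data _≡ₛ_ : ∀ {n} → WProc n → WProc n → Set where
  s-refl   : ∀ {n} {P : WProc n} → P ≡ₛ P
  s-sym    : ∀ {n} {P Q : WProc n} → P ≡ₛ Q → Q ≡ₛ P
  s-trans  : ∀ {n} {P Q R : WProc n} → P ≡ₛ Q → Q ≡ₛ R → P ≡ₛ R
  s-par    : ∀ {n} {P P' Q Q' : WProc n} → P ≡ₛ P' → Q ≡ₛ Q' → wpar P Q ≡ₛ wpar P' Q'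
  s-inp    : ∀ {n} {a : WVal n} {k P P'} → P ≡ₛ P' → winp a k P ≡ₛ winp a k P'
  s-rep    : ∀ {n} {a : WVal n} {k P P'} → P ≡ₛ P' → wrep a k P ≡ₛ wrep a k P'
  s-nu     : ∀ {n} {P P' : WProc (2 + n)} → P ≡ₛ P' → wnu P ≡ₛ wnu P'
  s-nil    : ∀ {n} {P : WProc n} → wpar P wnil ≡ₛ P
  s-comm   : ∀ {n} {P Q : WProc n} → wpar P Q ≡ₛ wpar Q P
  s-assoc  : ∀ {n} {P Q R : WProc n} → wpar (wpar P Q) R ≡ₛ wpar P (wpar Q R)
  s-nu-nil : ∀ {n} → wnu {n} wnil ≡ₛ wnil
  s-nu-nu  : ∀ {n} {P : WProc (2 + (2 + n))} → wnu (wnu P) ≡ₛ wnu (wnu (wsub swap4 P))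
  s-extr   : ∀ {n} {P : WProc (2 + n)} {Q : WProc n} → wpar (wnu P) Q ≡ₛ wnu (wpar P (wwk 2 Q))

data _⟶_ : ∀ {n} → WProc n → WProc n → Set where
  r-com : ∀ {n k} {P : WProc (k + (2 + n))} {vs : Vec (WVal (2 + n)) k} {Q : WProc (2 + n)} →
          wnu (wpar (winp (wvar zero) k P) (wpar (wout (wvar (suc zero)) vs) Q))
            ⟶ wnu (wpar (winst vs P) Q)
  r-rep : ∀ {n k} {P : WProc (k + (2 + n))} {vs : Vec (WVal (2 + n)) k} {Q : WProc (2 + n)} →
          wnu (wpar (wrep (wvar zero) k P) (wpar (wout (wvar (suc zero)) vs) Q))
            ⟶ wnu (wpar (winst vs P) (wpar (wrep (wvar zero) k P) Q))
  r-par : ∀ {n} {P P' Q : WProc n} → P ⟶ P' → wpar P Q ⟶ wpar P' Q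
  r-nu  : ∀ {n} {P P' : WProc (2 + n)} → P ⟶ P' → wnu P ⟶ wnu P'
  r-str : ∀ {n} {P P₁ P₂ P' : WProc n} → P ≡ₛ P₁ → P₁ ⟶ P₂ → P₂ ≡ₛ P' → P ⟶ P'

-- output of ⋆ at a success name ω_w  (P ≡ (ν…)(ω̄⟨⋆⟩ | P''), P' ≡ (ν…)P'')
data WOut : ∀ {n} → ℕ → WProc n → WProc n → Set where
  o-ax  : ∀ {n w} → WOut {n} w (wout (wsn w) (w⋆ ∷ [])) wnil
  o-par : ∀ {n w} {P P' Q : WProc n} → WOut w P P' → WOut w (wpar P Q) (wpar P' Q)
  o-nu  : ∀ {n w} {P P' : WProc (2 + n)} → WOut w P P' → WOut w (wnu P) (wnu P')
  o-str : ∀ {n w} {P P₁ P₂ P' : WProc n} → P ≡ₛ P₁ → WOut w P₁ P₂ → P₂ ≡ₛ P' → WOut w P P'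

-- The encoding [[·]]_f : ALπ → AWπ
-- ρ maps each ALπ name to the AWπ O-name it becomes;
-- f is the paper's finite map (meaningful on restricted names only;
-- on other names it is never consulted for well-typed processes).

Env : ℕ → ℕ → Set
Env n m = Fin n → WVal m

trV : ∀ {n m} → Env n m → Val n → WVal m
trV ρ (var i) = ρ i
trV ρ (sn w)  = wsn w
trV ρ ⋆       = w⋆

fV : ∀ {n m} → Env n m → Env n m → Val n → WVal m
fV ρ f (var i) = f i
fV ρ f a       = trV ρ a

mutual
  enc : ∀ {n m} → Env n m → Env n m → Proc n → WProc m
  enc ρ f nil       = wnil
  enc ρ f (par P Q) = wpar (enc ρ f P) (enc ρ f Q)
  enc ρ f (out a c) = wout (trV ρ a) (trV ρ c ∷ [])
  enc ρ f (inp a P) = encInp ρ f a P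
  -- (ν d↔d')( d̄'⟨⋆⟩ | !d(u).( d̄'⟨⋆⟩ | [[a(y).P]]_f ) )
  enc ρ f (rep a P) =
    wnu (wpar (wout (wvar (# 1)) (w⋆ ∷ []))
              (wrep (wvar (# 0)) 1
                 (wpar (wout (wvar (# 2)) (w⋆ ∷ []))
                       (encInp (λ i → wwkV 3 (ρ i)) (λ i → wwkV 3 (f i)) a P))))
  -- (ν â↔a)(ν b̂↔b)(ν ĉ↔c)( [[P]]_{f[a↦b]} | c̄⟨â,b̂⟩ | !ĉ(a',b').a'(x).b'(y).(c̄⟨a',b'⟩ | ȳ⟨x⟩) )
  -- inside: ĉ = 0, c = 1, b̂ = 2, b = 3, â = 4, a = 5
  enc {n} {m} ρ f (nu P) =
    wnu (wnu (wnu
      (wpar (enc ρ' f' P)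
            (wpar (wout (wvar (# 1)) (wvar (# 4) ∷ wvar (# 2) ∷ []))
                  (wrep (wvar (# 0)) 2
                     -- a' = 0, b' = 1, c = 3
                     (winp (wvar (# 0)) 1
                        -- x = 0, a' = 1, b' = 2, c = 4
                        (winp (wvar (# 2)) 1
                           -- y = 0, x = 1, a' = 2, b' = 3, c = 5
                           (wpar (wout (wvar (# 5)) (wvar (# 2) ∷ wvar (# 3) ∷ []))
                                 (wout (wvar (# 0)) (wvar (# 1) ∷ []))))))))))
    where
      ρ' : Env (suc n) (2 + (2 + (2 + m)))
      ρ' zero    = wvar (# 5)
      ρ' (suc i) = wwkV 6 (ρ i)
      f' : Env (suc n) (2 + (2 + (2 + m)))
      f' zero    = wvar (# 3)
      f' (suc i) = wwkV 6 (f i)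

  -- [[a(y).P]]_f = (ν z↔z')( \overline{f(a)}⟨z'⟩ | z(y).[[P]]_f ),  z = 0, z' = 1
  encInp : ∀ {n m} → Env n m → Env n m → Val n → Proc (suc n) → WProc m
  encInp {n} {m} ρ f a P =
    wnu (wpar (wout (wwkV 2 (fV ρ f a)) (wvar (# 1) ∷ []))
              (winp (wvar (# 0)) 1 (enc ρ'' f'' P)))
    where
      ρ'' : Env (suc n) (1 + (2 + m))
      ρ'' zero    = wvar (# 0)
      ρ'' (suc i) = wwkV 3 (ρ i)
      f'' : Env (suc n) (1 + (2 + m))
      f'' zero    = wvar (# 0)
      f'' (suc i) = wwkV 3 (f i)

emptyEnv : ∀ {m} → Env 0 m
emptyEnv ()

⟦_⟧∅ : Proc 0 → WProc 0
⟦ P ⟧∅ = enc emptyEnv emptyEnv P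

data Obs : Set where
  τo : Obs
  ωo : ℕ → Obs

record ObsLTS : Set₁ where
  field
    State : Set
    step  : State → Obs → State → Set

open ObsLTS public

τ⇒ : (L : ObsLTS) → State L → State L → Set
τ⇒ L = Star (λ P Q → step L P τo Q)

weakStep : (L : ObsLTS) → State L → Obs → State L → Set
weakStep L Q τo     Q' = τ⇒ L Q Q'
weakStep L Q (ωo w) Q' =
  Σ (State L) λ Q₁ → Σ (State L) λ Q₂ → τ⇒ L Q Q₁ × step L Q₁ (ωo w) Q₂ × τ⇒ L Q₂ Q'

IsWeakSim : (L M : ObsLTS) → (State L → State M → Set) → Set
IsWeakSim L M S = ∀ {P Q P'} μ → S P Q → step L P μ P' →
  Σ (State M) λ Q' → weakStep M Q μ Q' × S P' Q'

WeaklySimulates : (L M : ObsLTS) → State L → State M → Set₁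
WeaklySimulates L M P Q = Σ (State L → State M → Set) λ S → IsWeakSim L M S × S P Q

WeakSimEquiv : (L M : ObsLTS) → State L → State M → Set₁
WeakSimEquiv L M P Q = WeaklySimulates L M P Q × WeaklySimulates M L Q P

ALπ : ObsLTS
ALπ = record { State = Proc 0 ; step = st }
  where
  st : Proc 0 → Obs → Proc 0 → Set
  st P τo     P' = Step P τ P'
  st P (ωo w) P' = Step P (outA (sn w) ⋆) P'

AWπ : ObsLTS
AWπ = record { State = WProc 0 ; step = st }
  where
  st : WProc 0 → Obs → WProc 0 → Set
  st P τo     P' = P ⟶ P'
  st P (ωo w) P' = WOut w P P'

{-# OPTIONS --safe #-}

-- Both calculi are interpreted in one higher-order syntax Sem, in which binders are functions on
-- names and structural congruence involves no substitution.  A term is flattened to the multiset of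
-- its top-level prefixes and outputs, with arbitrary identifiers for its restrictions.  Flattening is
-- invariant under structural congruence, reductions of AWπ are exactly the synchronisations in the
-- multiset, and the transitions of ALπ (with scope extrusion) are as well.  It then suffices to
-- compare multisets: every atom of a state reachable from an encoding stands for a message, an input,
-- or administrative data.  In the direction from the encoding to the process, only the last step of the
-- protocol (the delivery on the reply channel z) is matched by a communication; all earlier steps are
-- matched by none.  Conversely, a communication is answered by the four steps of the protocol,
-- preceded by an unfolding when the input is replicated.
module Submission where

open import Defs
import Algebra.Solver.CommutativeMonoid as CMSolver
open import Data.Empty using (⊥; ⊥-elim)
open import Data.Fin using (Fin; zero; suc; splitAt; _↑ʳ_)
open import Data.Fin.Properties using (splitAt-↑ˡ; splitAt-↑ʳ)
open import Data.List using (List; []; _∷_; _++_; [_])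
import Data.List.Properties as List
open import Data.List.Membership.Propositional using (_∈_; _∉_)
open import Data.List.Membership.Propositional.Properties using (∈-++⁺ˡ; ∈-++⁺ʳ)
import Data.List.Relation.Binary.Permutation.Propositional as Perm
import Data.List.Relation.Binary.Permutation.Propositional.Properties as PermP
import Data.List.Relation.Binary.Permutation.Setoid as SPerm
import Data.List.Relation.Binary.Permutation.Setoid.Properties as SPermP
import Data.List.Relation.Binary.Pointwise as PW
open import Data.List.Relation.Unary.All as All using (All; []; _∷_)
import Data.List.Relation.Unary.All.Properties as AllP
open import Data.List.Relation.Unary.AllPairs using ([]; _∷_)
open import Data.List.Relation.Unary.Any using (here; there)
open import Data.List.Relation.Unary.Unique.Propositional using (Unique)
import Data.List.Relation.Unary.Unique.Propositional.Properties as UniqueP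
import Data.Nat as ℕ
open import Data.Nat using (ℕ; zero; suc; _+_; _≤_; _<_)
import Data.Nat.Properties as ℕP
open import Data.Product using (_×_; _,_; ∃; ∃₂; proj₁; proj₂; Σ-syntax)
open import Data.Product.Properties using (≡-dec)
open import Data.Sum using (_⊎_; inj₁; inj₂; [_,_]′)
open import Data.Unit using (⊤; tt)
import Data.Vec as Vec
open import Data.Vec using (Vec; []; _∷_; lookup)
open import Data.Vec.Properties using (lookup-map; map-∘; map-cong)
open import Function using (_∘_; id)
open import Relation.Binary.Bundles using (Setoid)
open import Relation.Binary.Construct.Closure.ReflexiveTransitive using (ε; _◅_)
open import Relation.Binary.PropositionalEquality
  using (_≡_; _≢_; refl; sym; trans; cong; subst; setoid)
open import Relation.Nullary using (yes; no; Dec)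

-- Structural congruence is symmetric, transitive and closed under prefixes, so a reduction of AWπ
-- cannot be inverted by cases on its derivation; the multisets supply this inversion. Naming is
-- asymmetric: a transition yields a synchronisation under any choice of identifiers, even with
-- repetitions, whereas turning a synchronisation back into a transition relies on different
-- restrictions having different identifiers. Hence in both simulations the challenging process
-- carries only `Flat°`, and the answering one carries `Alive`: distinct identifiers below a bound
-- from which new ones are drawn. The two simulation relations differ, because a half-finished
-- protocol run commits a message or an input that ALπ still offers to every partner. `Decoded`
-- admits such states and counts what is committed as still available. `Encoded` contains only
-- states in which every manager is idle and every request unanswered, so that each communication
-- can run the protocol to its end. Typing ensures that every input subject is a restricted name,
-- for which the map f has a request channel.

Id : Set
Id = ℕ × ℕ × ℕ

data Name : Set where
  inN outN : Id → Name
  succN    : ℕ → Name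
  star     : Name

data Guard : Set where
  once many : Guard

data Sem : Set where
  𝟎    : Sem
  _∥_  : Sem → Sem → Sem
  pre  : Guard → Name → (k : ℕ) → (Vec Name k → Sem) → Sem
  send : Name → {k : ℕ} → Vec Name k → Sem
  new  : (Id → Sem) → Sem

infixr 5 _∥_
infix 4 _~_ _≈_ _≈ₐ_

-- Takes the place of propositional equality: bodies are functions, and two interpretations that
-- agree at every argument would be equal only by function extensionality.
data _~_ : Sem → Sem → Set where
  𝟎~    : 𝟎 ~ 𝟎
  par~  : ∀ {p p' q q'} → p ~ p' → q ~ q' → p ∥ q ~ p' ∥ q'
  pre~  : ∀ {g a k f h} → (∀ vs → f vs ~ h vs) → pre g a k f ~ pre g a k h
  send~ : ∀ {a k} {vs : Vec Name k} → send a vs ~ send a vs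
  new~  : ∀ {f h} → (∀ x → f x ~ h x) → new f ~ new h

~-refl : ∀ {p} → p ~ p
~-refl {𝟎}          = 𝟎~
~-refl {p ∥ q}      = par~ ~-refl ~-refl
~-refl {pre g a k f} = pre~ λ _ → ~-refl
~-refl {send a vs}  = send~
~-refl {new f}      = new~ λ _ → ~-refl

~-sym : ∀ {p q} → p ~ q → q ~ p
~-sym 𝟎~         = 𝟎~
~-sym (par~ r s) = par~ (~-sym r) (~-sym s)
~-sym (pre~ r)   = pre~ λ vs → ~-sym (r vs)
~-sym send~      = send~
~-sym (new~ r)   = new~ λ x → ~-sym (r x)

~-trans : ∀ {p q r} → p ~ q → q ~ r → p ~ r
~-trans 𝟎~         𝟎~           = 𝟎~
~-trans (par~ r s) (par~ r' s') = par~ (~-trans r r') (~-trans s s')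
~-trans (pre~ r)   (pre~ r')    = pre~ λ vs → ~-trans (r vs) (r' vs)
~-trans send~      send~        = send~
~-trans (new~ r)   (new~ r')    = new~ λ x → ~-trans (r x) (r' x)

data _≈_ : Sem → Sem → Set where
  emb     : ∀ {p q} → p ~ q → p ≈ q
  ≈-sym   : ∀ {p q} → p ≈ q → q ≈ p
  ≈-trans : ∀ {p q r} → p ≈ q → q ≈ r → p ≈ r
  par≈    : ∀ {p p' q q'} → p ≈ p' → q ≈ q' → p ∥ q ≈ p' ∥ q'
  pre≈    : ∀ {g a k f h} → (∀ vs → f vs ≈ h vs) → pre g a k f ≈ pre g a k h
  new≈    : ∀ {f h} → (∀ x → f x ≈ h x) → new f ≈ new h
  nil≈    : ∀ {p} → p ∥ 𝟎 ≈ p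
  comm≈   : ∀ {p q} → p ∥ q ≈ q ∥ p
  assoc≈  : ∀ {p q r} → (p ∥ q) ∥ r ≈ p ∥ (q ∥ r)
  newnil≈ : new (λ _ → 𝟎) ≈ 𝟎
  newnew≈ : ∀ {f : Id → Id → Sem} → new (λ x → new (f x)) ≈ new (λ y → new (λ x → f x y))
  extr≈   : ∀ {f q} → new f ∥ q ≈ new (λ x → f x ∥ q)

≈-refl : ∀ {p} → p ≈ p
≈-refl = emb ~-refl

data Atom : Set where
  preA  : Guard → Name → (k : ℕ) → (Vec Name k → Sem) → Atom
  sendA : Name → {k : ℕ} → Vec Name k → Atom

-- Continuations are compared up to `≈` because structural congruence also acts under prefixes.
data _≈ₐ_ : Atom → Atom → Set where
  pre≈ₐ  : ∀ {g a k f h} → (∀ vs → f vs ≈ h vs) → preA g a k f ≈ₐ preA g a k h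
  send≈ₐ : ∀ {a k} {vs : Vec Name k} → sendA a vs ≈ₐ sendA a vs

≈ₐ-refl : ∀ {x} → x ≈ₐ x
≈ₐ-refl {preA g a k f} = pre≈ₐ λ _ → ≈-refl
≈ₐ-refl {sendA a vs}   = send≈ₐ

≈ₐ-sym : ∀ {x y} → x ≈ₐ y → y ≈ₐ x
≈ₐ-sym (pre≈ₐ e) = pre≈ₐ λ vs → ≈-sym (e vs)
≈ₐ-sym send≈ₐ    = send≈ₐ

≈ₐ-trans : ∀ {x y z} → x ≈ₐ y → y ≈ₐ z → x ≈ₐ z
≈ₐ-trans (pre≈ₐ e) (pre≈ₐ e') = pre≈ₐ λ vs → ≈-trans (e vs) (e' vs)
≈ₐ-trans send≈ₐ    send≈ₐ     = send≈ₐ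

atomSetoid : Setoid _ _
atomSetoid = record
  { Carrier = Atom ; _≈_ = _≈ₐ_
  ; isEquivalence = record { refl = ≈ₐ-refl ; sym = ≈ₐ-sym ; trans = ≈ₐ-trans } }

Bag Ids : Set
Bag = List Atom
Ids = List Id

open SPerm atomSetoid
  using () renaming (_↭_ to _≋_; ↭-refl to ≋-refl; ↭-sym to ≋-sym; ↭-trans to ≋-trans; ↭-prep to ≋-prep)
module B = SPermP atomSetoid
open Perm using (_↭_; ↭-refl; ↭-sym; ↭-trans)
module BS = CMSolver B.++-commutativeMonoid


-- Multisets of atoms

-- Locates an atom by its position, so that structures indexed by the list, such as `Items` and
-- `Settled`, can be taken apart along it; a permutation offers no such handle.
data Pick (x : Atom) : Bag → Bag → Set where
  here  : ∀ {L} → Pick x (x ∷ L) L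
  there : ∀ {y L M} → Pick x L M → Pick x (y ∷ L) (y ∷ M)

pick⇒≋ : ∀ {x L M} → Pick x L M → L ≋ x ∷ M
pick⇒≋ here      = ≋-refl
pick⇒≋ (there p) = SPerm.trans (≋-prep _ (pick⇒≋ p)) (SPerm.swap ≈ₐ-refl ≈ₐ-refl ≋-refl)

pick-resp : ∀ {x L M N} → L ≋ N → Pick x N M →
            ∃₂ λ y L' → Pick y L L' × y ≈ₐ x × L' ≋ M
pick-resp (SPerm.refl (e PW.∷ es)) here = _ , _ , here , e , SPerm.refl es
pick-resp (SPerm.refl (e PW.∷ es)) (there p) with pick-resp (SPerm.refl es) p
... | _ , _ , q , e' , r = _ , _ , there q , e' , SPerm.prep e r
pick-resp (SPerm.prep e r) here = _ , _ , here , e , r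
pick-resp (SPerm.prep e r) (there p) with pick-resp r p
... | _ , _ , q , e' , r' = _ , _ , there q , e' , SPerm.prep e r'
pick-resp (SPerm.swap e₁ e₂ r) here = _ , _ , there here , e₂ , SPerm.prep e₁ r
pick-resp (SPerm.swap e₁ e₂ r) (there here) = _ , _ , here , e₁ , SPerm.prep e₂ r
pick-resp (SPerm.swap e₁ e₂ r) (there (there p)) with pick-resp r p
... | _ , _ , q , e' , r' = _ , _ , there (there q) , e' , SPerm.swap e₁ e₂ r'
pick-resp (SPerm.trans r s) p with pick-resp s p
... | _ , _ , q , e , t with pick-resp r q
... | _ , _ , q' , e' , t' = _ , _ , q' , ≈ₐ-trans e' e , ≋-trans t' t

pick-≋ : ∀ {x L M} → L ≋ x ∷ M → ∃₂ λ y L' → Pick y L L' × y ≈ₐ x × L' ≋ M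
pick-≋ r = pick-resp r here

≋-cons : ∀ {x y L M} → x ≈ₐ y → L ≋ M → x ∷ L ≋ y ∷ M
≋-cons = SPerm.prep

pick-++ : ∀ {x} L₁ {L₂ M} → Pick x (L₁ ++ L₂) M →
          (∃ λ N → Pick x L₁ N × M ≡ N ++ L₂) ⊎ (∃ λ N → Pick x L₂ N × M ≡ L₁ ++ N)
pick-++ []       p    = inj₂ (_ , p , refl)
pick-++ (y ∷ L₁) here = inj₁ (_ , here , refl)
pick-++ (y ∷ L₁) (there p) with pick-++ L₁ p
... | inj₁ (N , q , refl) = inj₁ (_ , there q , refl)
... | inj₂ (N , q , refl) = inj₂ (_ , q , refl)

split-≋ : ∀ {x} L₁ {L₂ M} → L₁ ++ L₂ ≋ x ∷ M →
          (∃ λ N → L₁ ≋ x ∷ N × M ≋ N ++ L₂) ⊎ (∃ λ N → L₂ ≋ x ∷ N × M ≋ L₁ ++ N)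
split-≋ L₁ r with pick-≋ r
... | y , L' , p , e , s with pick-++ L₁ p
... | inj₁ (N , q , refl) = inj₁ (N , ≋-trans (pick⇒≋ q) (≋-cons e ≋-refl) , ≋-sym s)
... | inj₂ (N , q , refl) = inj₂ (N , ≋-trans (pick⇒≋ q) (≋-cons e ≋-refl) , ≋-sym s)

[]≋-absurd : ∀ {x M} {A : Set} → [] ≋ x ∷ M → A
[]≋-absurd r with pick-≋ r
... | _ , _ , () , _

singleton-≋ : ∀ {x y M} → [ y ] ≋ x ∷ M → y ≈ₐ x × M ≋ []
singleton-≋ r with pick-≋ r
... | _ , _ , here , e , s = e , ≋-sym s

-- Flattening and its invariance under structural congruence

-- Flat p X L: p has the atoms L when its restrictions are named from distinct positions of the list X;
-- the leaves absorb the unused positions.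
Flat : Sem → Ids → Bag → Set
Flat 𝟎             X L = L ≋ []
Flat (p ∥ q)       X L = Σ[ X₁ ∈ Ids ] Σ[ X₂ ∈ Ids ] Σ[ L₁ ∈ Bag ] Σ[ L₂ ∈ Bag ]
                         (Flat p X₁ L₁ × Flat q X₂ L₂ × X₁ ++ X₂ ↭ X × L ≋ L₁ ++ L₂)
Flat (pre g a k f) X L = L ≋ [ preA g a k f ]
Flat (send a vs)   X L = L ≋ [ sendA a vs ]
Flat (new f)       X L = Σ[ x ∈ Id ] Σ[ X' ∈ Ids ] (Flat (f x) X' L × x ∷ X' ↭ X)

flat-≋ : ∀ p {X L M} → L ≋ M → Flat p X L → Flat p X M
flat-≋ 𝟎 r fl = ≋-trans (≋-sym r) fl
flat-≋ (p ∥ q) r (_ , _ , _ , _ , f₁ , f₂ , s , t) = _ , _ , _ , _ , f₁ , f₂ , s , ≋-trans (≋-sym r) t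
flat-≋ (pre g a k f) r fl = ≋-trans (≋-sym r) fl
flat-≋ (send a vs) r fl = ≋-trans (≋-sym r) fl
flat-≋ (new f) r (x , _ , fl , s) = x , _ , flat-≋ (f x) r fl , s

flat-↭ : ∀ p {X Y L} → X ↭ Y → Flat p X L → Flat p Y L
flat-↭ 𝟎 r fl = fl
flat-↭ (p ∥ q) r (_ , _ , _ , _ , f₁ , f₂ , s , t) = _ , _ , _ , _ , f₁ , f₂ , ↭-trans s r , t
flat-↭ (pre g a k f) r fl = fl
flat-↭ (send a vs) r fl = fl
flat-↭ (new f) r (x , _ , fl , s) = x , _ , fl , ↭-trans s r

flat-weaken : ∀ p {x X L} → Flat p X L → Flat p (x ∷ X) L
flat-weaken 𝟎 fl = fl
flat-weaken (p ∥ q) (_ , _ , _ , _ , f₁ , f₂ , s , t) =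
  _ , _ , _ , _ , flat-weaken p f₁ , f₂ , Perm.prep _ s , t
flat-weaken (pre g a k f) fl = fl
flat-weaken (send a vs) fl = fl
flat-weaken (new f) (x , _ , fl , s) =
  x , _ , flat-weaken (f x) fl , ↭-trans (Perm.swap _ _ ↭-refl) (Perm.prep _ s)

flat-weaken* : ∀ p Y {X L} → Flat p X L → Flat p (Y ++ X) L
flat-weaken* p []      fl = fl
flat-weaken* p (y ∷ Y) fl = flat-weaken p (flat-weaken* p Y fl)

flat-~ : ∀ {p q} → p ~ q → ∀ {X L} → Flat p X L → Flat q X L
flat-~ 𝟎~ fl = fl
flat-~ (par~ r s) (_ , _ , _ , _ , f₁ , f₂ , t) = _ , _ , _ , _ , flat-~ r f₁ , flat-~ s f₂ , t
flat-~ (pre~ r) fl = ≋-trans fl (≋-cons (pre≈ₐ λ vs → emb (r vs)) ≋-refl)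
flat-~ send~ fl = fl
flat-~ (new~ r) (x , _ , fl , s) = x , _ , flat-~ (r x) fl , s

-- Structural congruence may create restrictions (0 ≡ (ν)0), which need additional identifiers.
data Up (Q : Ids → Set) : Ids → Set where
  done : ∀ {X} → Q X → Up Q X
  more : ∀ {X} → (∀ x → Up Q (x ∷ X)) → Up Q X

Up-bind : ∀ {Q R X} → Up Q X → (∀ {Y} → Q Y → Up R Y) → Up R X
Up-bind (done q) h = h q
Up-bind (more u) h = more λ x → Up-bind (u x) h

Up-map : ∀ {Q R : Ids → Set} {X} → (∀ {Y} → Q Y → R Y) → Up Q X → Up R X
Up-map h u = Up-bind u (done ∘ h)

Up-↭ : ∀ {Q : Ids → Set} → (∀ {X Y} → X ↭ Y → Q X → Q Y) → ∀ {X Y} → X ↭ Y → Up Q X → Up Q Y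
Up-↭ h r (done q) = done (h r q)
Up-↭ h r (more u) = more λ x → Up-↭ h (Perm.prep x r) (u x)

Up-par : ∀ {p q L₁ L₂ X₁ X₂} → Up (λ Y → Flat p Y L₁) X₁ → Up (λ Y → Flat q Y L₂) X₂ →
         Up (λ Y → Flat (p ∥ q) Y (L₁ ++ L₂)) (X₁ ++ X₂)
Up-par (done f₁) (done f₂) = done (_ , _ , _ , _ , f₁ , f₂ , ↭-refl , ≋-refl)
Up-par {p} {q} (done {X₁} f₁) (more u) = more λ x →
  Up-↭ (λ r → flat-↭ (p ∥ q) r) (PermP.shift x X₁ _) (Up-par {p} {q} (done f₁) (u x))
Up-par {p} {q} (more u) u' = more λ x → Up-par {p} {q} (u x) u'

Up-new : ∀ {f x L X} → Up (λ Y → Flat (f x) Y L) X → Up (λ Y → Flat (new f) Y L) (x ∷ X)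
Up-new (done fl) = done (_ , _ , fl , ↭-refl)
Up-new {f} (more u) = more λ y →
  Up-↭ (λ r → flat-↭ (new f) r) (Perm.swap _ _ ↭-refl) (Up-new {f} (u y))

Up-≋ : ∀ p {L M X} → L ≋ M → Up (λ Y → Flat p Y L) X → Up (λ Y → Flat p Y M) X
Up-≋ p r = Up-map (flat-≋ p r)

Up-flat-↭ : ∀ p {L X Y} → X ↭ Y → Up (λ Z → Flat p Z L) X → Up (λ Z → Flat p Z L) Y
Up-flat-↭ p = Up-↭ (λ r → flat-↭ p r)

dummy : Id
dummy = 0 , 0 , 0

-- Every demand for an identifier is met with `dummy`, which suffices for `Flat°`, where identifiers
-- may repeat.
Up-some : ∀ {Q X} → Up Q X → ∃ Q
Up-some (done q) = _ , q
Up-some (more u) = Up-some (u dummy)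

-- The multiset stays the same; only the identifiers vary. Both directions are proved at once so
-- that `≈-sym` merely exchanges them. Additional identifiers originate in one place: `newnil≈` read
-- from right to left.
flat-≈ : ∀ {p q} → p ≈ q → (∀ {X L} → Flat p X L → Up (λ Y → Flat q Y L) X)
                         × (∀ {X L} → Flat q X L → Up (λ Y → Flat p Y L) X)
flat-≈ (emb r) = (λ fl → done (flat-~ r fl)) , (λ fl → done (flat-~ (~-sym r) fl))
flat-≈ (≈-sym e) = let h , h' = flat-≈ e in h' , h
flat-≈ (≈-trans e e') = let h , h' = flat-≈ e ; j , j' = flat-≈ e' in
  (λ fl → Up-bind (h fl) j) , (λ fl → Up-bind (j' fl) h')
flat-≈ (par≈ {p} {p'} {q} {q'} e e') = let h , h' = flat-≈ e ; j , j' = flat-≈ e' in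
  (λ (_ , _ , _ , _ , f₁ , f₂ , s , t) →
     Up-≋ (p' ∥ q') (≋-sym t) (Up-flat-↭ (p' ∥ q') s (Up-par {p'} {q'} (h f₁) (j f₂)))) ,
  (λ (_ , _ , _ , _ , f₁ , f₂ , s , t) →
     Up-≋ (p ∥ q) (≋-sym t) (Up-flat-↭ (p ∥ q) s (Up-par {p} {q} (h' f₁) (j' f₂))))
flat-≈ (pre≈ e) =
  (λ fl → done (≋-trans fl (≋-cons (pre≈ₐ e) ≋-refl))) ,
  (λ fl → done (≋-trans fl (≋-cons (≈ₐ-sym (pre≈ₐ e)) ≋-refl)))
flat-≈ (new≈ {f} {f'} e) =
  (λ (x , _ , fl , s) → Up-flat-↭ (new f') s (Up-new {f'} (proj₁ (flat-≈ (e x)) fl))) ,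
  (λ (x , _ , fl , s) → Up-flat-↭ (new f) s (Up-new {f} (proj₂ (flat-≈ (e x)) fl)))
flat-≈ (nil≈ {p}) =
  (λ (X₁ , X₂ , L₁ , L₂ , f₁ , f₂ , s , t) →
     done (flat-≋ p (≋-sym (≋-trans t (≋-trans (B.++⁺ˡ L₁ f₂) (B.++-identityʳ L₁))))
       -- The identifiers that `𝟎` had absorbed are handed over to `p`.
       (flat-↭ p (↭-trans (PermP.++-comm X₂ X₁) s) (flat-weaken* p X₂ f₁)))) ,
  (λ {X} {L} fl → done (X , [] , L , [] , fl , ≋-refl , PermP.++-identityʳ X , ≋-sym (B.++-identityʳ L)))
flat-≈ comm≈ = swp , swp
  where
  swp : ∀ {p q X L} → Flat (p ∥ q) X L → Up (λ Y → Flat (q ∥ p) Y L) X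
  swp (X₁ , X₂ , L₁ , L₂ , f₁ , f₂ , s , t) =
    done (X₂ , X₁ , L₂ , L₁ , f₂ , f₁ , ↭-trans (PermP.++-comm X₂ X₁) s , ≋-trans t (B.++-comm L₁ L₂))
flat-≈ assoc≈ =
  (λ (_ , X₃ , _ , L₃ , (X₁ , X₂ , L₁ , L₂ , f₁ , f₂ , s , t) , f₃ , s' , t') →
     done (_ , _ , _ , _ , f₁ , (_ , _ , _ , _ , f₂ , f₃ , ↭-refl , ≋-refl) ,
       ↭-trans (↭-sym (PermP.++-assoc X₁ X₂ X₃)) (↭-trans (PermP.++⁺ʳ X₃ s) s') ,
       ≋-trans t' (≋-trans (B.++⁺ʳ L₃ t) (B.++-assoc L₁ L₂ L₃)))) ,
  (λ (X₁ , _ , L₁ , _ , f₁ , (X₂ , X₃ , L₂ , L₃ , f₂ , f₃ , s , t) , s' , t') →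
     done (_ , _ , _ , _ , (_ , _ , _ , _ , f₁ , f₂ , ↭-refl , ≋-refl) , f₃ ,
       ↭-trans (PermP.++-assoc X₁ X₂ X₃) (↭-trans (PermP.++⁺ˡ X₁ s) s') ,
       ≋-trans t' (≋-trans (B.++⁺ˡ L₁ t) (≋-sym (B.++-assoc L₁ L₂ L₃)))))
flat-≈ newnil≈ = (λ (_ , _ , fl , _) → done fl) , (λ fl → more λ x → done (x , _ , fl , ↭-refl))
flat-≈ newnew≈ = swp , swp
  where
  swp : ∀ {f : Id → Id → Sem} {X L} → Flat (new λ x → new (f x)) X L →
        Up (λ Y → Flat (new λ y → new (λ x → f x y)) Y L) X
  swp (x , _ , (y , _ , fl , s) , s') =
    done (y , _ , (x , _ , fl , ↭-refl) ,
          ↭-trans (Perm.swap _ _ ↭-refl) (↭-trans (Perm.prep _ s) s'))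
flat-≈ (extr≈ {f} {q}) =
  (λ (_ , X₂ , _ , _ , (x , _ , f₁ , s) , f₂ , s' , t) →
     done (x , _ , (_ , _ , _ , _ , f₁ , f₂ , ↭-refl , t) ,
           ↭-trans (PermP.++⁺ʳ X₂ s) s')) ,
  (λ (x , _ , (_ , _ , _ , _ , f₁ , f₂ , s , t) , s') →
     done (_ , _ , _ , _ , (x , _ , f₁ , ↭-refl) , f₂ , ↭-trans (Perm.prep x s) s' , t))

flat-≈→ : ∀ {p q} → p ≈ q → ∀ {X L} → Flat p X L → Up (λ Y → Flat q Y L) X
flat-≈→ e = proj₁ (flat-≈ e)

-- Reductions of AWπ

NEnv : ℕ → Set
NEnv n = Fin n → Name

extend : ∀ {n k} → Vec Name k → NEnv n → NEnv (k + n)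
extend {k = k} vs η i = [ lookup vs , η ]′ (splitAt k i)

wval : ∀ {n} → NEnv n → WVal n → Name
wval η (wvar i) = η i
wval η (wsn w)  = succN w
wval η w⋆       = star

W⟪_⟫ : ∀ {n} → WProc n → NEnv n → Sem
W⟪ wnil ⟫       η = 𝟎
W⟪ wpar P Q ⟫   η = W⟪ P ⟫ η ∥ W⟪ Q ⟫ η
W⟪ winp a k P ⟫ η = pre once (wval η a) k λ vs → W⟪ P ⟫ (extend vs η)
W⟪ wrep a k P ⟫ η = pre many (wval η a) k λ vs → W⟪ P ⟫ (extend vs η)
W⟪ wout a vs ⟫  η = send (wval η a) (Vec.map (wval η) vs)
W⟪ wnu P ⟫      η = new λ x → W⟪ P ⟫ (extend (inN x ∷ outN x ∷ []) η)

wval-sub : ∀ {n m} {θ : WSub n m} {η : NEnv m} {η' : NEnv n} → (∀ i → wval η (θ i) ≡ η' i) →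
           ∀ a → wval η (wsubV θ a) ≡ wval η' a
wval-sub h (wvar i) = h i
wval-sub h (wsn w)  = refl
wval-sub h w⋆       = refl

wval-wk : ∀ {n} k (vs : Vec Name k) (η : NEnv n) a → wval (extend vs η) (wwkV k a) ≡ wval η a
wval-wk k vs η (wvar i) rewrite splitAt-↑ʳ k _ i = refl
wval-wk k vs η (wsn w)  = refl
wval-wk k vs η w⋆       = refl

extend-wexts : ∀ {n m} {θ : WSub n m} {η : NEnv m} {η' : NEnv n} → (∀ i → wval η (θ i) ≡ η' i) →
               ∀ k (vs : Vec Name k) i → wval (extend vs η) (wexts k θ i) ≡ extend vs η' i
extend-wexts {m = m} {θ} {η} h k vs i with splitAt k i
... | inj₁ j rewrite splitAt-↑ˡ k j m = refl
... | inj₂ j = trans (wval-wk k vs η (θ j)) (h j)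

W⟪⟫-sub : ∀ {n m} (P : WProc n) {θ : WSub n m} {η : NEnv m} {η' : NEnv n} →
          (∀ i → wval η (θ i) ≡ η' i) → W⟪ wsub θ P ⟫ η ~ W⟪ P ⟫ η'
W⟪⟫-sub wnil h = 𝟎~
W⟪⟫-sub (wpar P Q) h = par~ (W⟪⟫-sub P h) (W⟪⟫-sub Q h)
W⟪⟫-sub (winp a k P) {θ} {η} {η'} h rewrite wval-sub {θ = θ} {η} {η'} h a = pre~ λ vs → W⟪⟫-sub P (extend-wexts h k vs)
W⟪⟫-sub (wrep a k P) {θ} {η} {η'} h rewrite wval-sub {θ = θ} {η} {η'} h a = pre~ λ vs → W⟪⟫-sub P (extend-wexts h k vs)
W⟪⟫-sub (wout a vs) {θ} {η} {η'} h
  rewrite wval-sub {θ = θ} {η} {η'} h a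
        | sym (map-∘ (wval η) (wsubV θ) vs)
        | map-cong (wval-sub {θ = θ} {η} {η'} h) vs = send~
W⟪⟫-sub (wnu P) h = new~ λ x → W⟪⟫-sub P (extend-wexts h 2 (inN x ∷ outN x ∷ []))

extend-↑ʳ : ∀ {n} k (vs : Vec Name k) (η : NEnv n) i → extend vs η (k ↑ʳ i) ≡ η i
extend-↑ʳ k vs η i rewrite splitAt-↑ʳ k _ i = refl

W⟪⟫-wwk : ∀ {n} k (P : WProc n) (vs : Vec Name k) {η} → W⟪ wwk k P ⟫ (extend vs η) ~ W⟪ P ⟫ η
W⟪⟫-wwk k P vs {η} = W⟪⟫-sub P (extend-↑ʳ k vs η)

-- instSub is the substitution local to winst, which cannot be named but is determined by W⟪⟫-winst.
mutual
  instSub : ∀ {n k} → WProc (k + n) → Vec (WVal n) k → WSub (k + n) n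
  instSub P vs = _

  W⟪⟫-winst : ∀ {n k} (P : WProc (k + n)) (vs : Vec (WVal n) k) {η} →
              W⟪ winst vs P ⟫ η ~ W⟪ P ⟫ (extend (Vec.map (wval η) vs) η)
  W⟪⟫-winst P vs {η} = W⟪⟫-sub P {instSub P vs} (winst-env P vs η)

  winst-env : ∀ {n k} (P : WProc (k + n)) (vs : Vec (WVal n) k) η i →
              wval η (instSub P vs i) ≡ extend (Vec.map (wval η) vs) η i
  winst-env {k = k} P vs η i with splitAt k i
  ... | inj₁ j = sym (lookup-map j (wval η) vs)
  ... | inj₂ j = refl

W⟪⟫-swap4 : ∀ {n} (P : WProc (4 + n)) {η a b c d} →
            W⟪ wsub swap4 P ⟫ (extend (a ∷ b ∷ []) (extend (c ∷ d ∷ []) η))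
            ~ W⟪ P ⟫ (extend (c ∷ d ∷ []) (extend (a ∷ b ∷ []) η))
W⟪⟫-swap4 P = W⟪⟫-sub P λ where
  zero → refl
  (suc zero) → refl
  (suc (suc zero)) → refl
  (suc (suc (suc zero))) → refl
  (suc (suc (suc (suc i)))) → refl

≡ₛ⇒≈ : ∀ {n} {P Q : WProc n} → P ≡ₛ Q → ∀ η → W⟪ P ⟫ η ≈ W⟪ Q ⟫ η
≡ₛ⇒≈ s-refl η = ≈-refl
≡ₛ⇒≈ (s-sym e) η = ≈-sym (≡ₛ⇒≈ e η)
≡ₛ⇒≈ (s-trans e e') η = ≈-trans (≡ₛ⇒≈ e η) (≡ₛ⇒≈ e' η)
≡ₛ⇒≈ (s-par e e') η = par≈ (≡ₛ⇒≈ e η) (≡ₛ⇒≈ e' η)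
≡ₛ⇒≈ (s-inp e) η = pre≈ λ vs → ≡ₛ⇒≈ e (extend vs η)
≡ₛ⇒≈ (s-rep e) η = pre≈ λ vs → ≡ₛ⇒≈ e (extend vs η)
≡ₛ⇒≈ (s-nu e) η = new≈ λ x → ≡ₛ⇒≈ e _
≡ₛ⇒≈ s-nil η = nil≈
≡ₛ⇒≈ s-comm η = comm≈
≡ₛ⇒≈ s-assoc η = assoc≈
≡ₛ⇒≈ s-nu-nil η = newnil≈
≡ₛ⇒≈ (s-nu-nu {P = P}) η =
  ≈-trans newnew≈ (emb (new~ λ _ → new~ λ _ → ~-sym (W⟪⟫-swap4 P)))
≡ₛ⇒≈ (s-extr {Q = Q}) η =
  ≈-trans extr≈ (emb (new~ λ x → par~ ~-refl (~-sym (W⟪⟫-wwk 2 Q (inN x ∷ outN x ∷ [])))))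

flat-≡ₛ : ∀ {n} {P Q : WProc n} → P ≡ₛ Q → ∀ {η X L} →
          Flat (W⟪ P ⟫ η) X L → Up (λ Y → Flat (W⟪ Q ⟫ η) Y L) X
flat-≡ₛ e = flat-≈→ (≡ₛ⇒≈ e _)

left : Guard → Name → (k : ℕ) → (Vec Name k → Sem) → Bag
left once a k f = []
left many a k f = [ preA many a k f ]

record Comm (a b : Name) (L : Bag) : Set where
  constructor mkComm
  field
    g    : Guard
    k    : ℕ
    f    : Vec Name k → Sem
    vs   : Vec Name k
    rest : Bag
    eq   : L ≋ preA g a k f ∷ sendA b vs ∷ rest

  residue : Bag
  residue = left g a k f ++ rest

open Comm

Comm-≋ : ∀ {a b L M} → M ≋ L → Comm a b L → Comm a b M
Comm-≋ r (mkComm g k f vs L₀ e) = mkComm g k f vs L₀ (≋-trans r e)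

Comm-++ : ∀ {a b L} → Comm a b L → ∀ M → Comm a b (L ++ M)
Comm-++ (mkComm g k f vs L₀ e) M = mkComm g k f vs (L₀ ++ M) (B.++⁺ʳ M e)

record Flat° (p : Sem) (L : Bag) : Set where
  constructor flat°
  field
    {ids} : Ids
    flat  : Flat p ids L

flat°-≈ : ∀ {p q L} → p ≈ q → Flat° p L → Flat° q L
flat°-≈ e (flat° fl) = flat° (proj₂ (Up-some (flat-≈→ e fl)))

flat°-~ : ∀ {p q L} → p ~ q → Flat° p L → Flat° q L
flat°-~ e (flat° fl) = flat° (flat-~ e fl)

flat°-≋ : ∀ {p L M} → L ≋ M → Flat° p L → Flat° p M
flat°-≋ {p} r (flat° fl) = flat° (flat-≋ p r fl)

flat°-par : ∀ {p q L M} → Flat° p L → Flat° q M → Flat° (p ∥ q) (L ++ M)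
flat°-par (flat° {X} f₁) (flat° {Y} f₂) = flat° {ids = X ++ Y} (_ , _ , _ , _ , f₁ , f₂ , ↭-refl , ≋-refl)

flat°-new : ∀ {f L} x → Flat° (f x) L → Flat° (new f) L
flat°-new x (flat° {X} fl) = flat° {ids = x ∷ X} (x , X , fl , ↭-refl)

-- The flattening of the instantiated body is an argument of the last component: the caller decides
-- how the restrictions released by the body are named. Congruence steps are absorbed by the
-- invariance of flattening.
⟶-flat : ∀ {n} {P P' : WProc n} → P ⟶ P' → ∀ {η L} → Flat° (W⟪ P ⟫ η) L →
         ∃ λ x → Σ[ c ∈ Comm (inN x) (outN x) L ]
           (∀ {M} → Flat° (f c (vs c)) M → Flat° (W⟪ P' ⟫ η) (M ++ residue c))
⟶-flat (r-com {P = P} {vs = us}) {η} {L}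
  (flat° (x , _ , (_ , _ , _ , _ , i , (_ , _ , _ , L₀ , j , fl , _ , r') , _ , r) , _)) =
  x , mkComm once _ _ _ L₀ (≋-trans r (B.++⁺ i (≋-trans r' (B.++⁺ʳ L₀ j)))) ,
  λ fM → flat°-new x (flat°-par (flat°-~ (~-sym (W⟪⟫-winst P us)) fM) (flat° fl))
⟶-flat (r-rep {P = P} {vs = us}) {η} {L}
  (flat° (x , _ , (_ , _ , _ , _ , i , (_ , _ , _ , L₀ , j , fl , _ , r') , _ , r) , _)) =
  x , mkComm many _ _ _ L₀ (≋-trans r (B.++⁺ i (≋-trans r' (B.++⁺ʳ L₀ j)))) ,
  λ fM → flat°-new x (flat°-par (flat°-~ (~-sym (W⟪⟫-winst P us)) fM)
    (flat°-par (flat° {ids = []} ≋-refl) (flat° fl)))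
⟶-flat (r-par {P' = P'} {Q} s) {η} (flat° (_ , _ , L₁ , L₂ , f₁ , f₂ , _ , r)) with ⟶-flat s (flat° f₁)
... | x , c , h = x , Comm-≋ r (Comm-++ c L₂) ,
  λ {M} fM → flat°-≋
    (≋-trans (B.++-assoc M (residue c) L₂)
             (B.++⁺ˡ M (B.++-assoc (left (g c) _ _ _) (rest c) L₂)))
    (flat°-par (h fM) (flat° f₂))
⟶-flat (r-nu s) (flat° (y , _ , fl , _)) with ⟶-flat s (flat° fl)
... | x , c , h = x , c , λ fM → flat°-new y (h fM)
⟶-flat (r-str e s e') {η} fl with ⟶-flat s (flat°-≈ (≡ₛ⇒≈ e η) fl)
... | x , c , h = x , c , λ fM → flat°-≈ (≡ₛ⇒≈ e' η) (h fM)

WOut-flat : ∀ {n w} {P P' : WProc n} → WOut w P P' → ∀ {η L} → Flat° (W⟪ P ⟫ η) L →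
            ∃ λ M → L ≋ sendA (succN w) (star ∷ []) ∷ M × Flat° (W⟪ P' ⟫ η) M
WOut-flat o-ax (flat° fl) = [] , fl , flat° {ids = []} ≋-refl
WOut-flat (o-par s) (flat° (_ , _ , _ , L₂ , f₁ , f₂ , _ , r)) with WOut-flat s (flat° f₁)
... | M , e , fl = M ++ L₂ , ≋-trans r (B.++⁺ʳ L₂ e) , flat°-par fl (flat° f₂)
WOut-flat (o-nu s) (flat° (y , _ , fl , _)) with WOut-flat s (flat° fl)
... | M , e , fl' = M , e , flat°-new y fl'
WOut-flat (o-str e s e') {η} fl with WOut-flat s (flat°-≈ (≡ₛ⇒≈ e η) fl)
... | M , r , fl' = M , r , flat°-≈ (≡ₛ⇒≈ e' η) fl'

-- From synchronisations to reductions of AWπ, by prenex forms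

Unique-↭ : ∀ {X Y : Ids} → X ↭ Y → Unique X → Unique Y
Unique-↭ r = SPermP.Unique-resp-↭ (setoid Id) (Perm.↭⇒↭ₛ r)

unique-head : ∀ {x : Id} {X} → Unique (x ∷ X) → x ∉ X
unique-head (h ∷ _) = AllP.All¬⇒¬Any h

unique-tail : ∀ {x : Id} {X} → Unique (x ∷ X) → Unique X
unique-tail (_ ∷ u) = u

_≟ᵢ_ : (x y : Id) → Dec (x ≡ y)
_≟ᵢ_ = ≡-dec ℕ._≟_ (≡-dec ℕ._≟_ ℕ._≟_)

wpre : ∀ {n} → Guard → WVal n → (k : ℕ) → WProc (k + n) → WProc n
wpre once = winp
wpre many = wrep

data Soup {n} : WProc n → Set where
  nil  : Soup wnil
  par  : ∀ {P Q} → Soup P → Soup Q → Soup (wpar P Q)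
  pre  : ∀ g {a k P} → Soup (wpre g a k P)
  send : ∀ {k a} {vs : Vec _ k} → Soup (wout a vs)

-- The index counts the leading restrictions. It is the measure that makes `prenex-par` and
-- `react-inner` terminate, as their recursive calls are on derivations transformed by a
-- substitution.
data Prenex : ℕ → ∀ {n} → WProc n → Set where
  soup : ∀ {n} {P : WProc n} → Soup P → Prenex 0 P
  nu   : ∀ {d n} {P : WProc (2 + n)} → Prenex d P → Prenex (suc d) (wnu P)

soup-sub : ∀ {n m} {θ : WSub n m} {P} → Soup P → Soup (wsub θ P)
soup-sub nil        = nil
soup-sub (par p q)  = par (soup-sub p) (soup-sub q)
soup-sub (pre once) = pre once
soup-sub (pre many) = pre many
soup-sub send       = send

prenex-sub : ∀ {d n m} {θ : WSub n m} {P} → Prenex d P → Prenex d (wsub θ P)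
prenex-sub (soup p) = soup (soup-sub p)
prenex-sub (nu p)   = nu (prenex-sub p)

HasPrenex : ∀ {n} → WProc n → Set
HasPrenex P = ∃₂ λ d R → Prenex d R × P ≡ₛ R

prenex-par : ∀ {d e n} {P Q : WProc n} → Prenex d P → Prenex e Q → HasPrenex (wpar P Q)
prenex-par (soup p) (soup q) = _ , _ , soup (par p q) , s-refl
prenex-par (soup p) (nu q) with prenex-par (soup (soup-sub p)) q
... | _ , _ , r , e = _ , _ , nu r ,
  s-trans s-comm (s-trans s-extr (s-nu (s-trans s-comm e)))
prenex-par (nu p) q with prenex-par p (prenex-sub q)
... | _ , _ , r , e = _ , _ , nu r , s-trans s-extr (s-nu e)

prenex : ∀ {n} (P : WProc n) → HasPrenex P
prenex wnil         = _ , _ , soup nil , s-refl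
prenex (wpar P Q) with prenex P | prenex Q
... | _ , _ , p , e | _ , _ , q , e' with prenex-par p q
... | _ , _ , r , e'' = _ , _ , r , s-trans (s-par e e') e''
prenex (winp a k P) = _ , _ , soup (pre once) , s-refl
prenex (wrep a k P) = _ , _ , soup (pre many) , s-refl
prenex (wout a vs)  = _ , _ , soup send , s-refl
prenex (wnu P) with prenex P
... | _ , _ , p , e = _ , _ , nu p , s-nu e

soup-ids : ∀ {n} {P : WProc n} {η} → Soup P → ∀ {X L} → Flat (W⟪ P ⟫ η) X L → ∀ Y → Flat (W⟪ P ⟫ η) Y L
soup-ids nil fl Y = fl
soup-ids (par p q) (_ , _ , _ , _ , f₁ , f₂ , _ , r) Y =
  Y , [] , _ , _ , soup-ids p f₁ Y , soup-ids q f₂ [] , PermP.++-identityʳ Y , r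
soup-ids (pre once) fl Y = fl
soup-ids (pre many) fl Y = fl
soup-ids send fl Y = fl

record ExtractPre {n} (P : WProc n) (η : NEnv n) g a k (f : Vec Name k → Sem) (L : Bag) : Set where
  constructor mkPre
  field
    {subj}  : WVal n
    {body}  : WProc (k + n)
    {other} : WProc n
    shape   : P ≡ₛ wpar (wpre g subj k body) other
    soup'   : Soup other
    subj≡   : wval η subj ≡ a
    body≈   : ∀ vs → f vs ≈ W⟪ body ⟫ (extend vs η)
    flat    : Flat (W⟪ other ⟫ η) [] L

record ExtractOut {n} (P : WProc n) (η : NEnv n) b {k} (vs : Vec Name k) (L : Bag) : Set where
  constructor mkOut
  field
    {subj}  : WVal n
    {args}  : Vec (WVal n) k
    {other} : WProc n
    shape   : P ≡ₛ wpar (wout subj args) other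
    soup'   : Soup other
    subj≡   : wval η subj ≡ b
    args≡   : Vec.map (wval η) args ≡ vs
    flat    : Flat (W⟪ other ⟫ η) [] L

extract-left : ∀ {n} {P Q A R : WProc n} → P ≡ₛ wpar A R → wpar P Q ≡ₛ wpar A (wpar R Q)
extract-left e = s-trans (s-par e s-refl) s-assoc

extract-right : ∀ {n} {P Q A R : WProc n} → Q ≡ₛ wpar A R → wpar P Q ≡ₛ wpar A (wpar P R)
extract-right e =
  s-trans s-comm (s-trans (extract-left e) (s-par s-refl s-comm))

extractPre : ∀ {n} {P : WProc n} {η X L g a k f L₀} → Soup P → Flat (W⟪ P ⟫ η) X L →
             L ≋ preA g a k f ∷ L₀ → ExtractPre P η g a k f L₀
extractPre nil fl r = []≋-absurd (≋-trans (≋-sym fl) r)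
extractPre {P = wpar P Q} {η} (par p q) (_ , _ , L₁ , L₂ , f₁ , f₂ , _ , r') r
  with split-≋ L₁ (≋-trans (≋-sym r') r)
... | inj₁ (N , s , t) with extractPre p f₁ s
...   | mkPre e m c d h = mkPre (extract-left e) (par m q) c d
        (flat-≋ (_ ∥ W⟪ Q ⟫ η) (≋-sym t) ([] , [] , N , L₂ , h , soup-ids q f₂ [] , ↭-refl , ≋-refl))
extractPre {P = wpar P Q} {η} (par p q) (_ , _ , L₁ , L₂ , f₁ , f₂ , _ , r') r
  | inj₂ (N , s , t) with extractPre q f₂ s
...   | mkPre e m c d h = mkPre (extract-right e) (par p m) c d
        (flat-≋ (W⟪ P ⟫ η ∥ _) (≋-sym t) ([] , [] , L₁ , N , soup-ids p f₁ [] , h , ↭-refl , ≋-refl))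
extractPre (pre once) fl r with singleton-≋ (≋-trans (≋-sym fl) r)
... | pre≈ₐ e , s = mkPre (s-sym s-nil) nil refl (λ vs → ≈-sym (e vs)) s
extractPre (pre many) fl r with singleton-≋ (≋-trans (≋-sym fl) r)
... | pre≈ₐ e , s = mkPre (s-sym s-nil) nil refl (λ vs → ≈-sym (e vs)) s
extractPre send fl r with singleton-≋ (≋-trans (≋-sym fl) r)
... | () , _

extractOut : ∀ {n} {P : WProc n} {η X L b k} {vs : Vec Name k} {L₀} → Soup P → Flat (W⟪ P ⟫ η) X L →
             L ≋ sendA b vs ∷ L₀ → ExtractOut P η b vs L₀
extractOut nil fl r = []≋-absurd (≋-trans (≋-sym fl) r)
extractOut {P = wpar P Q} {η} (par p q) (_ , _ , L₁ , L₂ , f₁ , f₂ , _ , r') r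
  with split-≋ L₁ (≋-trans (≋-sym r') r)
... | inj₁ (N , s , t) with extractOut p f₁ s
...   | mkOut e m c d h = mkOut (extract-left e) (par m q) c d
        (flat-≋ (_ ∥ W⟪ Q ⟫ η) (≋-sym t) ([] , [] , N , L₂ , h , soup-ids q f₂ [] , ↭-refl , ≋-refl))
extractOut {P = wpar P Q} {η} (par p q) (_ , _ , L₁ , L₂ , f₁ , f₂ , _ , r') r
  | inj₂ (N , s , t) with extractOut q f₂ s
...   | mkOut e m c d h = mkOut (extract-right e) (par p m) c d
        (flat-≋ (W⟪ P ⟫ η ∥ _) (≋-sym t) ([] , [] , L₁ , N , soup-ids p f₁ [] , h , ↭-refl , ≋-refl))
extractOut (pre once) fl r with singleton-≋ (≋-trans (≋-sym fl) r)
... | () , _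
extractOut (pre many) fl r with singleton-≋ (≋-trans (≋-sym fl) r)
... | () , _
extractOut send fl r with singleton-≋ (≋-trans (≋-sym fl) r)
... | send≈ₐ , s = mkOut (s-sym s-nil) nil refl refl s

FreshFor : ∀ {n} → Id → NEnv n → Set
FreshFor x η = ∀ i → η i ≢ inN x × η i ≢ outN x

fresh-extend : ∀ {n x y} {η : NEnv n} → x ≢ y → FreshFor x η → FreshFor x (extend (inN y ∷ outN y ∷ []) η)
fresh-extend x≢y h zero          = (λ { refl → x≢y refl }) , λ ()
fresh-extend x≢y h (suc zero)    = (λ ()) , λ { refl → x≢y refl }
fresh-extend x≢y h (suc (suc i)) = h i

fresh-subject : ∀ {n x} {η : NEnv n} → FreshFor x η → ∀ a → wval η a ≢ inN x
fresh-subject h (wvar i) = proj₁ (h i)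
fresh-subject h (wsn w) ()
fresh-subject h w⋆ ()

-- `r-com` and `r-rep` demand that the redex use the two variables of the adjacent restriction.
-- Freshness of `x` in the environment turns an equality of names back into this equality of
-- variables.
input-subject : ∀ {n x} {η : NEnv n} → FreshFor x η → ∀ a →
                wval (extend (inN x ∷ outN x ∷ []) η) a ≡ inN x → a ≡ wvar zero
input-subject h (wvar zero) e = refl
input-subject h (wvar (suc (suc i))) e = ⊥-elim (proj₁ (h i) e)

output-subject : ∀ {n x} {η : NEnv n} → FreshFor x η → ∀ a →
                 wval (extend (inN x ∷ outN x ∷ []) η) a ≡ outN x → a ≡ wvar (suc zero)
output-subject h (wvar (suc zero)) e = refl
output-subject h (wvar (suc (suc i))) e = ⊥-elim (proj₂ (h i) e)

Reacts : ∀ {n} (P : WProc n) (η : NEnv n) {L x} → Ids → Comm (inN x) (outN x) L → Set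
Reacts P η X c = ∃ λ R → P ⟶ R ×
  (∀ {E M} → Flat (f c (vs c)) E M → Up (λ Y → Flat (W⟪ R ⟫ η) Y (M ++ residue c)) (E ++ X))

-- The binder of the redex is moved inwards, past the other restrictions, until it meets the redex.
react-inner : ∀ {d n} {P : WProc (2 + n)} {η x X L} → Prenex d P →
              Flat (W⟪ P ⟫ (extend (inN x ∷ outN x ∷ []) η)) X L → FreshFor x η → x ∉ X →
              (c : Comm (inN x) (outN x) L) → Reacts (wnu P) η (x ∷ X) c
react-inner {P = P} {η} {x} {X} (soup p) fl fr x∉ (mkComm g k f us L₀ r) with extractPre p fl r
... | mkPre {a} {B} {Q} e q a≡ B≈ h with extractOut q h ≋-refl
... | mkOut {b} {args} {Q'} e' q' b≡ refl h' with input-subject fr a a≡ | output-subject fr b b≡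
... | refl | refl = go g (s-nu (s-trans e (s-par s-refl e')))
  where
  η' = extend (inN x ∷ outN x ∷ []) η
  fl' : Flat (W⟪ Q' ⟫ η') X L₀
  fl' = soup-ids q' h' X
  rearrange : ∀ R {E N} → Up (λ Y → Flat (W⟪ R ⟫ η') Y N) (E ++ X) →
              Up (λ Y → Flat (W⟪ wnu R ⟫ η) Y N) (E ++ x ∷ X)
  rearrange R {E} u =
    Up-flat-↭ (W⟪ wnu R ⟫ η) (↭-sym (PermP.shift x E X)) (Up-new {λ x → W⟪ R ⟫ _} u)
  body : ∀ {E M} → Flat (f us) E M → Up (λ Y → Flat (W⟪ winst args B ⟫ η') Y M) E
  body fM = Up-map (flat-~ (~-sym (W⟪⟫-winst B args))) (flat-≈→ (B≈ _) fM)
  go : ∀ g → wnu P ≡ₛ wnu (wpar (wpre g (wvar zero) k B) (wpar (wout (wvar (suc zero)) args) Q')) →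
       ∃ λ R → wnu P ⟶ R × (∀ {E M} → Flat (f us) E M →
         Up (λ Y → Flat (W⟪ R ⟫ η) Y (M ++ left g (inN x) k f ++ L₀)) (E ++ x ∷ X))
  go once s = _ , r-str s r-com s-refl , λ fM →
    rearrange (wpar (winst args B) Q')
      (Up-par {W⟪ winst args B ⟫ η'} {W⟪ Q' ⟫ η'} (body fM) (done fl'))
  go many s = _ , r-str s r-rep s-refl , λ fM →
    rearrange (wpar (winst args B) (wpar (wrep (wvar zero) k B) Q'))
      (Up-par {W⟪ winst args B ⟫ η'} {W⟪ wpar (wrep (wvar zero) k B) Q' ⟫ η'} (body fM)
        (done ([] , X , _ , L₀ , ≋-refl , fl' , ↭-refl , ≋-cons (pre≈ₐ B≈) ≋-refl)))
react-inner {P = wnu P} {η} {x} {X} (nu p) (y , X₁ , fl , s) fr x∉ c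
  with react-inner {η = extend (inN y ∷ outN y ∷ []) η} (prenex-sub {θ = swap4} p)
         (flat-~ (~-sym (W⟪⟫-swap4 P)) fl)
         (fresh-extend (λ { refl → x∉ (PermP.∈-resp-↭ s (here refl)) }) fr)
         (λ i → x∉ (PermP.∈-resp-↭ s (there i))) c
... | R , st , h = wnu R , r-str s-nu-nu (r-nu st) s-refl , λ {E} {M} fM →
  Up-flat-↭ (W⟪ wnu R ⟫ η)
    (↭-trans (↭-sym (PermP.shift y E (x ∷ X₁)))
      (PermP.++⁺ˡ E (↭-trans (Perm.swap y x ↭-refl) (Perm.prep x s))))
    (Up-new {λ x → W⟪ R ⟫ _} (h fM))

-- Descends to the restriction named `x`. Since identifiers are distinct, no restriction further
-- inside has the same name, so the subjects of both atoms refer to this one.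
react : ∀ {d n} {P : WProc n} {η x X L} → Prenex d P → Flat (W⟪ P ⟫ η) X L → FreshFor x η → Unique X →
        (c : Comm (inN x) (outN x) L) → Reacts P η X c
react (soup p) fl fr u c with extractPre p fl (eq c)
... | mkPre {a} _ _ a≡ _ _ = ⊥-elim (fresh-subject fr a a≡)
react {η = η} {x} {X} (nu {P = P} p) (y , X₁ , fl , s) fr u c with x ≟ᵢ y
... | yes refl with react-inner p fl fr (unique-head (Unique-↭ (↭-sym s) u)) c
...   | R , st , h = R , st , λ {E} fM → Up-flat-↭ (W⟪ R ⟫ η) (PermP.++⁺ˡ E s) (h fM)
react {η = η} {x} {X} (nu {P = P} p) (y , X₁ , fl , s) fr u c | no x≢y
  with react p fl (fresh-extend x≢y fr) (unique-tail (Unique-↭ (↭-sym s) u)) c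
... | R , st , h = wnu R , r-nu st , λ {E} fM →
  Up-flat-↭ (W⟪ wnu R ⟫ η)
    (↭-trans (↭-sym (PermP.shift y E X₁)) (PermP.++⁺ˡ E s))
    (Up-new {λ x → W⟪ R ⟫ _} (h fM))

-- `o-ax` fires only on the constants `wsn` and `w⋆`; this condition rules out variables that denote
-- a success name or the star.
OnlyNames : ∀ {n} → NEnv n → Set
OnlyNames η = ∀ i → ∃ λ x → η i ≡ inN x ⊎ η i ≡ outN x

onlyNames-extend : ∀ {n x} {η : NEnv n} → OnlyNames η → OnlyNames (extend (inN x ∷ outN x ∷ []) η)
onlyNames-extend h zero          = _ , inj₁ refl
onlyNames-extend h (suc zero)    = _ , inj₂ refl
onlyNames-extend h (suc (suc i)) = h i

onlyNames-≢ : ∀ {n} {η : NEnv n} → OnlyNames η → ∀ i →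
              (∀ {w} → η i ≢ succN w) × η i ≢ star
onlyNames-≢ {η = η} h i with η i | h i
... | _ | _ , inj₁ refl = (λ ()) , λ ()
... | _ | _ , inj₂ refl = (λ ()) , λ ()

wval-succN : ∀ {n w} {η : NEnv n} → OnlyNames η → ∀ a → wval η a ≡ succN w → a ≡ wsn w
wval-succN h (wvar i) e = ⊥-elim (proj₁ (onlyNames-≢ h i) e)
wval-succN h (wsn w) refl = refl

wval-star : ∀ {n} {η : NEnv n} → OnlyNames η → ∀ a → wval η a ≡ star → a ≡ w⋆
wval-star h (wvar i) e = ⊥-elim (proj₂ (onlyNames-≢ h i) e)
wval-star h w⋆ e = refl

-- Stated for arbitrary names and vectors, because in `success-output` the two sides contain stuck
-- applications of `wval` on which `send≈ₐ` cannot be matched. Lists allow the two lengths to differ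
-- a priori.
send-inv : ∀ {a b k l} {vs : Vec Name k} {us : Vec Name l} → sendA a vs ≈ₐ sendA b us →
           a ≡ b × Vec.toList vs ≡ Vec.toList us
send-inv send≈ₐ = refl , refl

success-output : ∀ {n w k} {η : NEnv n} → OnlyNames η → ∀ a (vs : Vec (WVal n) k) →
                 sendA (wval η a) (Vec.map (wval η) vs) ≈ₐ sendA (succN w) (star ∷ []) →
                 WOut w (wout a vs) wnil
success-output h a vs e with send-inv e
success-output h a (v ∷ []) e | e₁ , e₂
  with wval-succN h a e₁ | wval-star h v (List.∷-injectiveˡ e₂)
... | refl | refl = o-ax

flat-WOut : ∀ {n} (P : WProc n) {η w X L M} → OnlyNames η → Flat (W⟪ P ⟫ η) X L →
            L ≋ sendA (succN w) (star ∷ []) ∷ M → ∃ λ P' → WOut w P P' × Flat (W⟪ P' ⟫ η) X M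
flat-WOut wnil h fl r = []≋-absurd (≋-trans (≋-sym fl) r)
flat-WOut (wpar P Q) {η} h (X₁ , X₂ , L₁ , L₂ , f₁ , f₂ , s , r') r
  with split-≋ L₁ (≋-trans (≋-sym r') r)
... | inj₁ (N , e , t) with flat-WOut P h f₁ e
...   | P' , st , fl = wpar P' Q , o-par st , X₁ , X₂ , N , L₂ , fl , f₂ , s , t
flat-WOut (wpar P Q) {η} h (X₁ , X₂ , L₁ , L₂ , f₁ , f₂ , s , r') r
    | inj₂ (N , e , t) with flat-WOut Q h f₂ e
...   | Q' , st , fl = wpar P Q' , o-str s-comm (o-par st) s-comm , X₁ , X₂ , L₁ , N , f₁ , fl , s , t
flat-WOut (winp a k P) h fl r with singleton-≋ (≋-trans (≋-sym fl) r)
... | () , _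
flat-WOut (wrep a k P) h fl r with singleton-≋ (≋-trans (≋-sym fl) r)
... | () , _
flat-WOut (wout a vs) h fl r with singleton-≋ (≋-trans (≋-sym fl) r)
... | e , s = wnil , success-output h a vs e , s
flat-WOut (wnu P) h (x , X₁ , fl , s) r with flat-WOut P (onlyNames-extend h) fl r
... | P' , st , fl' = wnu P' , o-nu st , x , X₁ , fl' , s

-- Allocation of identifiers

-- Only the last component is allocated; the others are labels. The identifiers a, b, c of one
-- restriction of ALπ can thus share a number.
num : Id → ℕ
num (_ , _ , k) = k

Below : ℕ → Ids → Set
Below k = All λ x → num x < k

-- Allocations over consecutive half-open intervals are disjoint, so the distinctness of a
-- concatenation follows from a comparison of bounds.
record Alloc (k k' : ℕ) (E : Ids) : Set where
  constructor mkAlloc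
  field
    k≤k'   : k ≤ k'
    unique : Unique E
    range  : All (λ x → k ≤ num x × num x < k') E

record Alive (p : Sem) (k : ℕ) (L : Bag) : Set where
  constructor alive
  field
    {ids}  : Ids
    unique : Unique ids
    below  : Below k ids
    flat   : Flat p ids L

alive-≋ : ∀ {p k L M} → L ≋ M → Alive p k L → Alive p k M
alive-≋ {p} r (alive u b fl) = alive u b (flat-≋ p r fl)

alive-up : ∀ {p k L X} → Up (λ Y → Flat p Y L) X → Unique X → Below k X → ∃ λ k' → Alive p k' L
alive-up (done fl) u b = _ , alive u b fl
alive-up {k = k} {X = X} (more h) u b =
  -- The bound `k` exceeds every number in `X`, so an identifier numbered `k` is new whatever its
  -- labels.
  alive-up (h (0 , 0 , k))
    (All.map (λ { {x} lt refl → ℕP.<-irrefl refl lt }) b ∷ u)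
    (ℕP.≤-refl ∷ All.map ℕP.m<n⇒m<1+n b)

alloc-disjoint : ∀ {k k' k'' E X} → Alloc k k' E → All (λ x → k' ≤ num x × num x < k'') X →
                 ∀ {x} → x ∈ E × x ∈ X → ⊥
alloc-disjoint (mkAlloc _ _ r) b (p , q) =
  ℕP.<⇒≱ (proj₂ (All.lookup r p)) (proj₁ (All.lookup b q))

alloc-++ : ∀ {k k' k'' E F} → Alloc k k' E → Alloc k' k'' F → Alloc k k'' (E ++ F)
alloc-++ a@(mkAlloc l u r) b@(mkAlloc l' u' r') = mkAlloc (ℕP.≤-trans l l')
  (UniqueP.++⁺ u u' (alloc-disjoint a r'))
  (AllP.++⁺ (All.map (λ (p , q) → p , ℕP.<-≤-trans q l') r)
            (All.map (λ (p , q) → ℕP.≤-trans l p , q) r'))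

below⇒alloc : ∀ {k X} → Unique X → Below k X → Alloc 0 k X
below⇒alloc u b = mkAlloc ℕ.z≤n u (All.map (ℕ.z≤n ,_) b)

alloc⇒below : ∀ {k X} → Alloc 0 k X → Below k X
alloc⇒below (mkAlloc _ _ r) = All.map proj₂ r

alive-alloc : ∀ {p k k' L X E} → Unique X → Below k X → Alloc k k' E →
              Up (λ Y → Flat p Y L) (E ++ X) → ∃ λ k'' → Alive p k'' L
alive-alloc {p} {X = X} {E} u b a up =
  alive-up (Up-flat-↭ p (PermP.++-comm E X) up) (Alloc.unique c) (alloc⇒below c)
  where c = alloc-++ (below⇒alloc u b) a

∅ : NEnv 0
∅ ()

-- Passing to the prenex form can itself demand identifiers. Hence the bound `k₁` above which the
-- body must be named is produced here and not given.
W-react : ∀ {P : WProc 0} {k x L} → Alive (W⟪ P ⟫ ∅) k L → (c : Comm (inN x) (outN x) L) →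
          ∃ λ k₁ → ∀ {k' E M} → Alloc k₁ k' E → Flat (f c (vs c)) E M →
            ∃₂ λ R k'' → P ⟶ R × Alive (W⟪ R ⟫ ∅) k'' (M ++ residue c)
W-react {P} (alive u b fl) c with prenex P
... | _ , P₀ , p , e with alive-up {W⟪ P₀ ⟫ ∅} (flat-≡ₛ e fl) u b
... | k₁ , alive u' b' fl' with react p fl' (λ ()) u' c
... | R , st , h = k₁ , λ a fM →
  let k'' , al = alive-alloc {W⟪ R ⟫ ∅} u' b' a (h fM) in R , k'' , r-str e st s-refl , al

W-success : ∀ {P : WProc 0} {k w L M} → Alive (W⟪ P ⟫ ∅) k L → L ≋ sendA (succN w) (star ∷ []) ∷ M →
            ∃ λ P' → WOut w P P' × Alive (W⟪ P' ⟫ ∅) k M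
W-success {P} (alive u b fl) r with flat-WOut P (λ ()) fl r
... | P' , st , fl' = P' , st , alive u b fl'

-- Transitions of ALπ

infixr 5 _▸_

_▸_ : ∀ {n} → Name → NEnv n → NEnv (suc n)
(v ▸ σ) zero    = v
(v ▸ σ) (suc i) = σ i

aval : ∀ {n} → NEnv n → Val n → Name
aval σ (var i) = σ i
aval σ (sn w)  = succN w
aval σ ⋆       = star

A⟪_⟫ : ∀ {n} → Proc n → NEnv n → Sem
A⟪ nil ⟫     σ = 𝟎
A⟪ par P Q ⟫ σ = A⟪ P ⟫ σ ∥ A⟪ Q ⟫ σ
A⟪ inp a P ⟫ σ = pre once (aval σ a) 1 λ vs → A⟪ P ⟫ (Vec.head vs ▸ σ)
A⟪ rep a P ⟫ σ = pre many (aval σ a) 1 λ vs → A⟪ P ⟫ (Vec.head vs ▸ σ)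
A⟪ out a c ⟫ σ = send (aval σ a) (aval σ c ∷ [])
A⟪ nu P ⟫    σ = new λ x → A⟪ P ⟫ (outN x ▸ σ)

aval-sub : ∀ {n m} {θ : Sub n m} {σ : NEnv m} {σ' : NEnv n} → (∀ i → aval σ (θ i) ≡ σ' i) →
           ∀ a → aval σ (subV θ a) ≡ aval σ' a
aval-sub h (var i) = h i
aval-sub h (sn w)  = refl
aval-sub h ⋆       = refl

aval-wk : ∀ {n v} {σ : NEnv n} a → aval (v ▸ σ) (wkV a) ≡ aval σ a
aval-wk (var i) = refl
aval-wk (sn w)  = refl
aval-wk ⋆       = refl

aval-exts : ∀ {n m} {θ : Sub n m} {σ : NEnv m} {σ' : NEnv n} → (∀ i → aval σ (θ i) ≡ σ' i) →
            ∀ v i → aval (v ▸ σ) (exts θ i) ≡ (v ▸ σ') i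
aval-exts h v zero = refl
aval-exts {θ = θ} h v (suc i) = trans (aval-wk (θ i)) (h i)

A⟪⟫-sub : ∀ {n m} (P : Proc n) {θ : Sub n m} {σ : NEnv m} {σ' : NEnv n} →
          (∀ i → aval σ (θ i) ≡ σ' i) → A⟪ sub θ P ⟫ σ ~ A⟪ P ⟫ σ'
A⟪⟫-sub nil h = 𝟎~
A⟪⟫-sub (par P Q) h = par~ (A⟪⟫-sub P h) (A⟪⟫-sub Q h)
A⟪⟫-sub (inp a P) {θ} {σ} {σ'} h rewrite aval-sub {θ = θ} {σ} {σ'} h a =
  pre~ λ vs → A⟪⟫-sub P (aval-exts {θ = θ} h (Vec.head vs))
A⟪⟫-sub (rep a P) {θ} {σ} {σ'} h rewrite aval-sub {θ = θ} {σ} {σ'} h a =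
  pre~ λ vs → A⟪⟫-sub P (aval-exts {θ = θ} h (Vec.head vs))
A⟪⟫-sub (out a c) {θ} {σ} {σ'} h
  rewrite aval-sub {θ = θ} {σ} {σ'} h a | aval-sub {θ = θ} {σ} {σ'} h c = send~
A⟪⟫-sub (nu P) {θ} h = new~ λ x → A⟪⟫-sub P (aval-exts {θ = θ} h (outN x))

A⟪⟫-wk : ∀ {n v} {σ : NEnv n} P → A⟪ wk P ⟫ (v ▸ σ) ~ A⟪ P ⟫ σ
A⟪⟫-wk P = A⟪⟫-sub P λ _ → refl

A⟪⟫-sub1 : ∀ {n} {σ : NEnv n} P c → A⟪ sub1 P c ⟫ σ ~ A⟪ P ⟫ (aval σ c ▸ σ)
A⟪⟫-sub1 P c = A⟪⟫-sub P λ { zero → refl ; (suc i) → refl }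

A⟪⟫-swap : ∀ {n u v} {σ : NEnv n} P → A⟪ swap P ⟫ (u ▸ v ▸ σ) ~ A⟪ P ⟫ (v ▸ u ▸ σ)
A⟪⟫-swap P = A⟪⟫-sub P λ { zero → refl ; (suc zero) → refl ; (suc (suc i)) → refl }

-- `next` holds for every `v` because the transition system is late: an input label fixes the
-- channel and leaves the value open.
record Input {n} (P' : Proc (suc n)) (σ : NEnv n) (a : Name) (L : Bag) : Set where
  constructor mkInput
  field
    g    : Guard
    f    : Vec Name 1 → Sem
    rest : Bag
    eq   : L ≋ preA g a 1 f ∷ rest
    next : ∀ {v M} → Flat° (f (v ∷ [])) M → Flat° (A⟪ P' ⟫ (v ▸ σ)) (M ++ left g a 1 f ++ rest)

record Tau {n} (P' : Proc n) (σ : NEnv n) (L : Bag) : Set where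
  constructor mkTau
  field
    {channel} : Name
    g      : Guard
    f      : Vec Name 1 → Sem
    {arg}  : Name
    rest   : Bag
    eq     : L ≋ preA g channel 1 f ∷ sendA channel (arg ∷ []) ∷ rest
    next   : ∀ {M} → Flat° (f (arg ∷ [])) M → Flat° (A⟪ P' ⟫ σ) (M ++ left g channel 1 f ++ rest)

step-out : ∀ {n} {P P' : Proc n} {a c} → Step P (outA a c) P' → ∀ {σ L} → Flat° (A⟪ P ⟫ σ) L →
           ∃ λ M → L ≋ sendA (aval σ a) (aval σ c ∷ []) ∷ M × Flat° (A⟪ P' ⟫ σ) M
step-out out-ax (flat° fl) = [] , fl , flat° {ids = []} ≋-refl
step-out (par-l s) (flat° (_ , _ , _ , L₂ , f₁ , f₂ , _ , r)) with step-out s (flat° f₁)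
... | M , e , fl = M ++ L₂ , ≋-trans r (B.++⁺ʳ L₂ e) , flat°-par fl (flat° f₂)
step-out (par-r s) (flat° (_ , _ , L₁ , _ , f₁ , f₂ , _ , r)) with step-out s (flat° f₂)
... | M , e , fl = L₁ ++ M , ≋-trans r (≋-trans (B.++⁺ˡ L₁ e) (B.↭-shift L₁ M)) , flat°-par (flat° f₁) fl
step-out {a = a} {c} (res s) {σ} (flat° (x , _ , fl , _)) with step-out s (flat° fl)
... | M , e , fl' rewrite aval-wk {v = outN x} {σ} a | aval-wk {v = outN x} {σ} c = M , e , flat°-new x fl'

-- Scope extrusion does not touch the other atoms: `opn` moves `x` from the identifiers into the
-- environment, and the close rules later turn it into an identifier again.
step-bout : ∀ {n} {P : Proc n} {a P'} → Step P (boutA a) P' → ∀ {σ L} → Flat° (A⟪ P ⟫ σ) L →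
            ∃₂ λ x M → L ≋ sendA (aval σ a) (outN x ∷ []) ∷ M × Flat° (A⟪ P' ⟫ (outN x ▸ σ)) M
step-bout (par-l {Q = Q} s) (flat° (_ , _ , _ , L₂ , f₁ , f₂ , _ , r)) with step-bout s (flat° f₁)
... | x , M , e , fl = x , M ++ L₂ , ≋-trans r (B.++⁺ʳ L₂ e) ,
  flat°-par fl (flat°-~ (~-sym (A⟪⟫-wk Q)) (flat° f₂))
step-bout (par-r {P = P} s) (flat° (_ , _ , L₁ , _ , f₁ , f₂ , _ , r)) with step-bout s (flat° f₂)
... | x , M , e , fl = x , L₁ ++ M , ≋-trans r (≋-trans (B.++⁺ˡ L₁ e) (B.↭-shift L₁ M)) ,
  flat°-par (flat°-~ (~-sym (A⟪⟫-wk P)) (flat° f₁)) fl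
step-bout {a = a} (res {P' = P'} s) {σ} (flat° (y , _ , fl , _)) with step-bout s (flat° fl)
... | x , M , e , fl' rewrite aval-wk {v = outN y} {σ} a =
  x , M , e , flat°-new y (flat°-~ (~-sym (A⟪⟫-swap P')) fl')
step-bout {a = a} (opn s) {σ} (flat° (x , _ , fl , _)) with step-out s (flat° fl)
... | M , e , fl' rewrite aval-wk {v = outN x} {σ} a = x , M , e , fl'

-- Opaque, because with-abstraction would otherwise normalise the proofs found by the solver.
module _ where
  open BS using (solve; _⊜_; _⊕_)

  opaque
    float-left : ∀ M N L₁ L₂ → (M ++ N ++ L₁) ++ L₂ ≋ M ++ N ++ L₁ ++ L₂
    float-left = solve 4 (λ m n a b → (m ⊕ n ⊕ a) ⊕ b ⊜ m ⊕ n ⊕ a ⊕ b) ≋-refl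

    float-right : ∀ M N L₁ L₂ → L₁ ++ M ++ N ++ L₂ ≋ M ++ N ++ L₁ ++ L₂
    float-right = solve 4 (λ m n a b → a ⊕ m ⊕ n ⊕ b ⊜ m ⊕ n ⊕ a ⊕ b) ≋-refl

    shift₂ : ∀ L₁ A B L₂ → L₁ ++ A ++ B ++ L₂ ≋ A ++ B ++ L₁ ++ L₂
    shift₂ = solve 4 (λ a x y b → a ⊕ x ⊕ y ⊕ b ⊜ x ⊕ y ⊕ a ⊕ b) ≋-refl

    gather-lr : ∀ A L₁ B L₂ → (A ++ L₁) ++ B ++ L₂ ≋ A ++ B ++ L₁ ++ L₂
    gather-lr = solve 4 (λ x a y b → (x ⊕ a) ⊕ y ⊕ b ⊜ x ⊕ y ⊕ a ⊕ b) ≋-refl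

    gather-rl : ∀ B L₁ A L₂ → (B ++ L₁) ++ A ++ L₂ ≋ A ++ B ++ L₁ ++ L₂
    gather-rl = solve 4 (λ y a x b → (y ⊕ a) ⊕ x ⊕ b ⊜ x ⊕ y ⊕ a ⊕ b) ≋-refl

step-in : ∀ {n} {P : Proc n} {a P'} → Step P (inpA a) P' → ∀ {σ L} → Flat° (A⟪ P ⟫ σ) L →
          Input P' σ (aval σ a) L
step-in inp-ax (flat° fl) =
  mkInput once _ [] fl λ {_} {M} fM → flat°-≋ (≋-sym (B.++-identityʳ M)) fM
step-in (rep-ax {a = a} {P}) (flat° fl) =
  mkInput many _ [] fl λ fM → flat°-par fM (flat°-~ (~-sym (A⟪⟫-wk (rep a P))) (flat° {ids = []} ≋-refl))
step-in (par-l {Q = Q} s) (flat° (_ , _ , _ , L₂ , f₁ , f₂ , _ , r)) with step-in s (flat° f₁)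
... | mkInput g f rs e h = mkInput g f (rs ++ L₂) (≋-trans r (B.++⁺ʳ L₂ e)) λ {_} {M} fM →
  flat°-≋ (float-left M (left g _ 1 f) rs L₂)
    (flat°-par (h fM) (flat°-~ (~-sym (A⟪⟫-wk Q)) (flat° f₂)))
step-in (par-r {P = P} s) (flat° (_ , _ , L₁ , _ , f₁ , f₂ , _ , r)) with step-in s (flat° f₂)
... | mkInput g f rs e h =
  mkInput g f (L₁ ++ rs) (≋-trans r (≋-trans (B.++⁺ˡ L₁ e) (B.↭-shift L₁ rs))) λ {_} {M} fM →
  flat°-≋ (float-right M (left g _ 1 f) L₁ rs)
    (flat°-par (flat°-~ (~-sym (A⟪⟫-wk P)) (flat° f₁)) (h fM))
step-in {a = a} (res {P' = P'} s) {σ} (flat° (y , _ , fl , _)) with step-in s (flat° fl)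
... | i rewrite aval-wk {v = outN y} {σ} a with i
... | mkInput g f rs e h = mkInput g f rs e λ fM →
  flat°-new y (flat°-~ (~-sym (A⟪⟫-swap P')) (h fM))

step-τ : ∀ {n} {P P' : Proc n} → Step P τ P' → ∀ {σ L} → Flat° (A⟪ P ⟫ σ) L → Tau P' σ L
step-τ (par-l s) (flat° (_ , _ , _ , L₂ , f₁ , f₂ , _ , r)) with step-τ s (flat° f₁)
... | mkTau g f rs e h = mkTau g f (rs ++ L₂) (≋-trans r (B.++⁺ʳ L₂ e)) λ {M} fM →
  flat°-≋ (float-left M (left g _ 1 f) rs L₂) (flat°-par (h fM) (flat° f₂))
step-τ (par-r s) (flat° (_ , _ , L₁ , _ , f₁ , f₂ , _ , r)) with step-τ s (flat° f₂)
... | mkTau g f rs e h = mkTau g f (L₁ ++ rs)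
  (≋-trans r (≋-trans (B.++⁺ˡ L₁ e) (shift₂ L₁ [ _ ] [ _ ] rs))) λ {M} fM →
  flat°-≋ (float-right M (left g _ 1 f) L₁ rs) (flat°-par (flat° f₁) (h fM))
step-τ (comm-l {c = c} {Q' = Q'} s t) (flat° (_ , _ , L₁ , L₂ , f₁ , f₂ , _ , r))
  with step-out s (flat° f₁) | step-in t (flat° f₂)
... | N , e , fl | mkInput g f rs e' h = mkTau g f (N ++ rs)
  (≋-trans r (≋-trans (B.++⁺ e e') (gather-rl [ _ ] N [ _ ] rs))) λ {M} fM →
  flat°-≋ (float-right M (left g _ 1 f) N rs)
    (flat°-par fl (flat°-~ (~-sym (A⟪⟫-sub1 Q' c)) (h fM)))
step-τ (comm-r {c = c} {P' = P'} s t) (flat° (_ , _ , L₁ , L₂ , f₁ , f₂ , _ , r))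
  with step-in s (flat° f₁) | step-out t (flat° f₂)
... | mkInput g f rs e' h | N , e , fl = mkTau g f (rs ++ N)
  (≋-trans r (≋-trans (B.++⁺ e' e) (gather-lr [ _ ] rs [ _ ] N))) λ {M} fM →
  flat°-≋ (float-left M (left g _ 1 f) rs N)
    (flat°-par (flat°-~ (~-sym (A⟪⟫-sub1 P' c)) (h fM)) fl)
step-τ (close-l s t) (flat° (_ , _ , L₁ , L₂ , f₁ , f₂ , _ , r))
  with step-bout s (flat° f₁) | step-in t (flat° f₂)
... | x , N , e , fl | mkInput g f rs e' h = mkTau g f (N ++ rs)
  (≋-trans r (≋-trans (B.++⁺ e e') (gather-rl [ _ ] N [ _ ] rs))) λ {M} fM →
  flat°-new x (flat°-≋ (float-right M (left g _ 1 f) N rs) (flat°-par fl (h fM)))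
step-τ (close-r s t) (flat° (_ , _ , L₁ , L₂ , f₁ , f₂ , _ , r))
  with step-in s (flat° f₁) | step-bout t (flat° f₂)
... | mkInput g f rs e' h | x , N , e , fl = mkTau g f (rs ++ N)
  (≋-trans r (≋-trans (B.++⁺ e' e) (gather-lr [ _ ] rs [ _ ] N))) λ {M} fM →
  flat°-new x (flat°-≋ (float-left M (left g _ 1 f) rs N) (flat°-par (h fM) fl))
step-τ (res s) (flat° (y , _ , fl , _)) with step-τ s (flat° fl)
... | mkTau g f rs e h = mkTau g f rs e λ fM → flat°-new y (h fM)

-- From synchronisations to transitions of ALπ

data WkView {n} : Val (suc n) → Set where
  top : WkView (var zero)
  old : ∀ a → WkView (wkV a)

wkView : ∀ {n} (a : Val (suc n)) → WkView a
wkView (var zero)    = top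
wkView (var (suc i)) = old (var i)
wkView (sn w)        = old (sn w)
wkView ⋆             = old ⋆

-- An output atom is a transition of `P` only if its subject is visible outside. In the case `bound`
-- the argument is a restricted name `x`, which leaves the list of identifiers by extrusion.
data Sends {n} (P : Proc n) (σ : NEnv n) (X : Ids) (a v : Name) (M : Bag) : Set where
  hidden : ∀ {x} → x ∈ X → a ≡ outN x → Sends P σ X a v M
  free   : ∀ {b c P'} → Step P (outA b c) P' → aval σ b ≡ a → aval σ c ≡ v →
           Flat (A⟪ P' ⟫ σ) X M → Sends P σ X a v M
  bound  : ∀ {b P' x X'} → Step P (boutA b) P' → aval σ b ≡ a → v ≡ outN x → x ∷ X' ↭ X →
           Flat (A⟪ P' ⟫ (outN x ▸ σ)) X' M → Sends P σ X a v M

sends : ∀ {n} (P : Proc n) {σ X L a v M} → Flat (A⟪ P ⟫ σ) X L → L ≋ sendA a (v ∷ []) ∷ M →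
        Sends P σ X a v M
sends nil fl r = []≋-absurd (≋-trans (≋-sym fl) r)
sends (par P Q) {σ} (X₁ , X₂ , L₁ , L₂ , f₁ , f₂ , s , r') r with split-≋ L₁ (≋-trans (≋-sym r') r)
sends (par P Q) {σ} (X₁ , X₂ , L₁ , L₂ , f₁ , f₂ , s , r') r | inj₁ (N , e , t) with sends P f₁ e
... | hidden x∈ a≡ = hidden (PermP.∈-resp-↭ s (∈-++⁺ˡ x∈)) a≡
... | free st b≡ c≡ fl = free (par-l st) b≡ c≡ (_ , _ , _ , _ , fl , f₂ , s , t)
... | bound st b≡ v≡ s' fl = bound (par-l st) b≡ v≡ (↭-trans (PermP.++⁺ʳ X₂ s') s)
        (_ , _ , _ , _ , fl , flat-~ (~-sym (A⟪⟫-wk Q)) f₂ , ↭-refl , t)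
sends (par P Q) {σ} (X₁ , X₂ , L₁ , L₂ , f₁ , f₂ , s , r') r | inj₂ (N , e , t) with sends Q f₂ e
... | hidden x∈ a≡ = hidden (PermP.∈-resp-↭ s (∈-++⁺ʳ X₁ x∈)) a≡
... | free st b≡ c≡ fl = free (par-r st) b≡ c≡ (_ , _ , _ , _ , f₁ , fl , s , t)
... | bound st b≡ v≡ s' fl = bound (par-r st) b≡ v≡
        (↭-trans (↭-sym (PermP.shift _ X₁ _)) (↭-trans (PermP.++⁺ˡ X₁ s') s))
        (_ , _ , _ , _ , flat-~ (~-sym (A⟪⟫-wk P)) f₁ , fl , ↭-refl , t)
sends (inp a P) fl r with singleton-≋ (≋-trans (≋-sym fl) r)
... | () , _
sends (rep a P) fl r with singleton-≋ (≋-trans (≋-sym fl) r)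
... | () , _
sends (out a c) fl r with singleton-≋ (≋-trans (≋-sym fl) r)
... | send≈ₐ , s = free out-ax refl refl s
sends (nu P) {σ} (x , X₁ , fl , s) r with sends P fl r
... | hidden y∈ a≡ = hidden (PermP.∈-resp-↭ s (there y∈)) a≡
sends (nu P) {σ} (x , X₁ , fl , s) r | free {b} {c} st b≡ c≡ fl' with wkView b | wkView c
... | top    | _      = hidden (PermP.∈-resp-↭ s (here refl)) (sym b≡)
... | old b' | top    = bound (opn st) (trans (sym (aval-wk b')) b≡) (sym c≡) s fl'
... | old b' | old c' = free (res st) (trans (sym (aval-wk b')) b≡) (trans (sym (aval-wk c')) c≡)
                          (x , X₁ , fl' , s)
sends (nu P) {σ} (x , X₁ , fl , s) r | bound {b} {P'} st b≡ v≡ s' fl' with wkView b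
... | top    = hidden (PermP.∈-resp-↭ s (here refl)) (sym b≡)
... | old b' = bound (res st) (trans (sym (aval-wk b')) b≡) v≡
                 (↭-trans (Perm.swap _ x ↭-refl) (↭-trans (Perm.prep x s') s))
                 (x , _ , flat-~ (~-sym (A⟪⟫-swap P')) fl' , ↭-refl)

data Receives {n} (P : Proc n) (σ : NEnv n) (X : Ids) g a (f : Vec Name 1 → Sem) (M : Bag) : Set where
  hidden  : ∀ {x} → x ∈ X → a ≡ outN x → Receives P σ X g a f M
  visible : ∀ {b P'} → Step P (inpA b) P' → aval σ b ≡ a →
            (∀ {v E N} → Flat (f (v ∷ [])) E N →
               Up (λ Y → Flat (A⟪ P' ⟫ (v ▸ σ)) Y (N ++ left g a 1 f ++ M)) (E ++ X)) →
            Receives P σ X g a f M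

flat-weaken-right : ∀ p {X L} Y → Flat p X L → Flat p (X ++ Y) L
flat-weaken-right p {X} Y fl = flat-↭ p (PermP.++-comm Y X) (flat-weaken* p Y fl)

ids-left : ∀ E X₁ {X₂ X : Ids} → X₁ ++ X₂ ↭ X → (E ++ X₁) ++ X₂ ↭ E ++ X
ids-left E X₁ {X₂} s = ↭-trans (PermP.++-assoc E X₁ X₂) (PermP.++⁺ˡ E s)

ids-right : ∀ E X₁ {X₂ X : Ids} → X₁ ++ X₂ ↭ X → X₁ ++ E ++ X₂ ↭ E ++ X
ids-right E X₁ s = ↭-trans (PermP.shifts X₁ E) (PermP.++⁺ˡ E s)

receives : ∀ {n} (P : Proc n) {σ X L g a f M} → Flat (A⟪ P ⟫ σ) X L → L ≋ preA g a 1 f ∷ M →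
           Receives P σ X g a f M
receives nil fl r = []≋-absurd (≋-trans (≋-sym fl) r)
receives (par P Q) {σ} {g = g} {f = f} (X₁ , X₂ , L₁ , L₂ , f₁ , f₂ , s , r') r
  with split-≋ L₁ (≋-trans (≋-sym r') r)
receives (par P Q) {σ} {g = g} {f = f} (X₁ , X₂ , L₁ , L₂ , f₁ , f₂ , s , r') r | inj₁ (N , e , t)
  with receives P f₁ e
... | hidden x∈ a≡ = hidden (PermP.∈-resp-↭ s (∈-++⁺ˡ x∈)) a≡
... | visible {P' = P'} st b≡ h = visible (par-l st) b≡ λ {v} {E} {K} fM →
  Up-≋ (A⟪ par P' (wk Q) ⟫ (v ▸ σ))
    (≋-trans (float-left K (left g _ 1 f) N L₂) (B.++⁺ˡ K (B.++⁺ˡ (left g _ 1 f) (≋-sym t))))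
    (Up-flat-↭ (A⟪ par P' (wk Q) ⟫ (v ▸ σ)) (ids-left E X₁ s)
      (Up-par {A⟪ P' ⟫ _} {A⟪ wk Q ⟫ _} (h fM) (done (flat-~ (~-sym (A⟪⟫-wk Q)) f₂))))
receives (par P Q) {σ} {g = g} {f = f} (X₁ , X₂ , L₁ , L₂ , f₁ , f₂ , s , r') r | inj₂ (N , e , t)
  with receives Q f₂ e
... | hidden x∈ a≡ = hidden (PermP.∈-resp-↭ s (∈-++⁺ʳ X₁ x∈)) a≡
... | visible {P' = P'} st b≡ h = visible (par-r st) b≡ λ {v} {E} {K} fM →
  Up-≋ (A⟪ par (wk P) P' ⟫ (v ▸ σ))
    (≋-trans (float-right K (left g _ 1 f) L₁ N) (B.++⁺ˡ K (B.++⁺ˡ (left g _ 1 f) (≋-sym t))))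
    (Up-flat-↭ (A⟪ par (wk P) P' ⟫ (v ▸ σ)) (ids-right E X₁ s)
      (Up-par {A⟪ wk P ⟫ _} {A⟪ P' ⟫ _} (done (flat-~ (~-sym (A⟪⟫-wk P)) f₁)) (h fM)))
receives (inp a P) {σ} {X} fl r with singleton-≋ (≋-trans (≋-sym fl) r)
... | pre≈ₐ e , s = visible inp-ax refl λ {v} {E} {K} fM →
  Up-map (λ {Y} → flat-≋ (A⟪ P ⟫ (v ▸ σ)) (≋-sym (≋-trans (B.++⁺ˡ K s) (B.++-identityʳ K))))
    (flat-≈→ (≈-sym (e _)) (flat-weaken-right _ X fM))
receives (rep a P) {σ} {X} fl r with singleton-≋ (≋-trans (≋-sym fl) r)
... | pre≈ₐ e , s = visible rep-ax refl λ {v} {E} {K} fM →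
  Up-par {A⟪ P ⟫ (v ▸ σ)} {A⟪ wk (rep a P) ⟫ (v ▸ σ)} (flat-≈→ (≈-sym (e _)) fM)
    (done (flat-~ (~-sym (A⟪⟫-wk (rep a P))) {X} (≋-cons (≈ₐ-sym (pre≈ₐ e)) s)))
receives (out a c) fl r with singleton-≋ (≋-trans (≋-sym fl) r)
... | () , _
receives (nu P) {σ} (x , X₁ , fl , s) r with receives P fl r
... | hidden y∈ a≡ = hidden (PermP.∈-resp-↭ s (there y∈)) a≡
... | visible {b} {P'} st b≡ h with wkView b
...   | top    = hidden (PermP.∈-resp-↭ s (here refl)) (sym b≡)
...   | old b' = visible (res st) (trans (sym (aval-wk b')) b≡) λ {v} {E} fM →
  Up-flat-↭ (A⟪ nu (swap P') ⟫ (v ▸ σ))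
    (↭-trans (↭-sym (PermP.shift x E X₁)) (PermP.++⁺ˡ E s))
    (Up-new {λ x → A⟪ swap P' ⟫ (outN x ▸ v ▸ σ)} (Up-map (flat-~ (~-sym (A⟪⟫-swap P'))) (h fM)))

-- The communication rules compare subjects as syntactic values, the atoms compare them as names;
-- injectivity leads from the latter back to the former.
Injective : ∀ {n} → NEnv n → Set
Injective σ = ∀ a b → aval σ a ≡ aval σ b → a ≡ b

Avoids : ∀ {n} → NEnv n → Ids → Set
Avoids σ X = ∀ {x} → x ∈ X → ∀ a → aval σ a ≢ outN x

injective-▸ : ∀ {n x} {σ : NEnv n} → Injective σ → (∀ a → aval σ a ≢ outN x) → Injective (outN x ▸ σ)
injective-▸ inj av a b e with wkView a | wkView b
... | top    | top    = refl
... | top    | old b' = ⊥-elim (av b' (trans (sym (aval-wk b')) (sym e)))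
... | old a' | top    = ⊥-elim (av a' (trans (sym (aval-wk a')) e))
... | old a' | old b' = cong wkV (inj a' b' (trans (sym (aval-wk a')) (trans e (aval-wk b'))))

avoids-▸ : ∀ {n x X} {σ : NEnv n} → Avoids σ X → x ∉ X → Avoids (outN x ▸ σ) X
avoids-▸ av x∉ y∈ a e with wkView a
avoids-▸ av x∉ y∈ _ refl | top    = x∉ y∈
...                      | old a' = av y∈ a' (trans (sym (aval-wk a')) e)

unique-++ : ∀ (X : Ids) {Y} → Unique (X ++ Y) → Unique X × Unique Y × (∀ {x} → x ∈ X → x ∉ Y)
unique-++ []      u       = [] , u , λ ()
unique-++ (x ∷ X) (h ∷ u) with unique-++ X u
... | u₁ , u₂ , dis = AllP.++⁻ˡ X h ∷ u₁ , u₂ , λ where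
  (here refl) q → All.lookup (AllP.++⁻ʳ X h) q refl
  (there p)   q → dis p q

ReactsA : ∀ {n} (P : Proc n) (σ : NEnv n) → Ids → Guard → Name → (Vec Name 1 → Sem) → Name → Bag → Set
ReactsA P σ X g a f v M = ∃ λ P' → Step P τ P' ×
  (∀ {E N} → Flat (f (v ∷ [])) E N → Up (λ Y → Flat (A⟪ P' ⟫ σ) Y (N ++ left g a 1 f ++ M)) (E ++ X))

-- The recursion stops at the parallel composition that separates the two atoms. There the
-- transitions of the components combine to a communication, or to a close if the argument is
-- restricted in the sender. A subject hidden on both sides contradicts the disjointness of their
-- identifiers; a subject hidden on one side and visible on the other contradicts `Avoids`.
reactA : ∀ {n} (P : Proc n) {σ X L g a f v M} → Injective σ → Avoids σ X → Unique X →
         Flat (A⟪ P ⟫ σ) X L → L ≋ preA g a 1 f ∷ sendA a (v ∷ []) ∷ M → ReactsA P σ X g a f v M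
reactA nil inj av u fl r = []≋-absurd (≋-trans (≋-sym fl) r)
reactA (inp a P) inj av u fl r with singleton-≋ (≋-trans (≋-sym fl) r)
... | _ , s = []≋-absurd (≋-sym s)
reactA (rep a P) inj av u fl r with singleton-≋ (≋-trans (≋-sym fl) r)
... | _ , s = []≋-absurd (≋-sym s)
reactA (out a c) inj av u fl r with singleton-≋ (≋-trans (≋-sym fl) r)
... | () , _
reactA (nu P) {σ} inj av u (x , X₁ , fl , s) r
  with u' ← Unique-↭ (↭-sym s) u
  with reactA P (injective-▸ inj (av (PermP.∈-resp-↭ s (here refl))))
         (avoids-▸ (av ∘ PermP.∈-resp-↭ s ∘ there) (unique-head u')) (unique-tail u') fl r
... | P' , st , h = nu P' , res st , λ {E} fM →
  Up-flat-↭ (A⟪ nu P' ⟫ σ) (↭-trans (↭-sym (PermP.shift x E X₁)) (PermP.++⁺ˡ E s))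
    (Up-new {λ x → A⟪ P' ⟫ (outN x ▸ σ)} (h fM))
reactA (par P Q) {σ} {g = g} {a} {f} {v} {M} inj av u (X₁ , X₂ , L₁ , L₂ , f₁ , f₂ , s , r') r
  with u₁ , u₂ , dis ← unique-++ X₁ (Unique-↭ (↭-sym s) u)
  with split-≋ L₁ (≋-trans (≋-sym r') r)
... | inj₁ (N , e , t) with split-≋ N (≋-sym t)
...   | inj₁ (N' , e' , t')
  with reactA P inj (av ∘ PermP.∈-resp-↭ s ∘ ∈-++⁺ˡ) u₁ f₁ (≋-trans e (≋-prep _ e'))
...     | P' , st , h = par P' Q , par-l st , λ {E} {K} fM →
  Up-≋ (A⟪ par P' Q ⟫ σ)
    (≋-trans (float-left K (left g _ 1 f) N' L₂) (B.++⁺ˡ K (B.++⁺ˡ (left g _ 1 f) (≋-sym t'))))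
    (Up-flat-↭ (A⟪ par P' Q ⟫ σ) (ids-left E X₁ s)
      (Up-par {A⟪ P' ⟫ _} {A⟪ Q ⟫ _} (h fM) (done f₂)))
reactA (par P Q) {σ} {g = g} {a} {f} {v} {M} inj av u (X₁ , X₂ , L₁ , L₂ , f₁ , f₂ , s , r') r
  | inj₁ (N , e , t) | inj₂ (N' , e' , t')
  with receives P f₁ e | sends Q f₂ e'
... | hidden x∈ refl | hidden y∈ refl = ⊥-elim (dis x∈ y∈)
... | hidden x∈ refl | free {b'} _ b≡ _ _ = ⊥-elim (av (PermP.∈-resp-↭ s (∈-++⁺ˡ x∈)) b' b≡)
... | hidden x∈ refl | bound {b'} _ b≡ _ _ _ = ⊥-elim (av (PermP.∈-resp-↭ s (∈-++⁺ˡ x∈)) b' b≡)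
... | visible {b'} _ b≡ _ | hidden x∈ refl = ⊥-elim (av (PermP.∈-resp-↭ s (∈-++⁺ʳ X₁ x∈)) b' b≡)
... | visible {b} {P'} st refl h | free {b'} {c} {Q'} st' b≡ refl fl with inj b' b b≡
...   | refl = par (sub1 P' c) Q' , comm-r st st' , λ {E} {K} fM →
  Up-≋ (A⟪ par (sub1 P' c) Q' ⟫ σ)
    (≋-trans (float-left K (left g _ 1 f) N N') (B.++⁺ˡ K (B.++⁺ˡ (left g _ 1 f) (≋-sym t'))))
    (Up-flat-↭ (A⟪ par (sub1 P' c) Q' ⟫ σ) (ids-left E X₁ s)
      (Up-par {A⟪ sub1 P' c ⟫ _} {A⟪ Q' ⟫ _} (Up-map (flat-~ (~-sym (A⟪⟫-sub1 P' c))) (h fM)) (done fl)))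
reactA (par P Q) {σ} {g = g} {a} {f} {v} {M} inj av u (X₁ , X₂ , L₁ , L₂ , f₁ , f₂ , s , r') r
  | inj₁ (N , e , t) | inj₂ (N' , e' , t')
  | visible {b} {P'} st refl h | bound {b'} {Q'} {x} {X'} st' b≡ refl s' fl with inj b' b b≡
...   | refl = nu (par P' Q') , close-r st st' , λ {E} {K} fM →
  Up-≋ (A⟪ nu (par P' Q') ⟫ σ)
    (≋-trans (float-left K (left g _ 1 f) N N') (B.++⁺ˡ K (B.++⁺ˡ (left g _ 1 f) (≋-sym t'))))
    (Up-flat-↭ (A⟪ nu (par P' Q') ⟫ σ)
      (↭-trans (↭-sym (PermP.shift x (E ++ X₁) X')) (↭-trans (PermP.++⁺ˡ (E ++ X₁) s') (ids-left E X₁ s)))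
      (Up-new {λ x → A⟪ par P' Q' ⟫ (outN x ▸ σ)}
        (Up-par {A⟪ P' ⟫ _} {A⟪ Q' ⟫ _} (h fM) (done fl))))
reactA (par P Q) {σ} {g = g} {a} {f} {v} {M} inj av u (X₁ , X₂ , L₁ , L₂ , f₁ , f₂ , s , r') r
  | inj₂ (N , e , t) with split-≋ L₁ (≋-sym t)
...   | inj₂ (N' , e' , t')
  with reactA Q inj (av ∘ PermP.∈-resp-↭ s ∘ ∈-++⁺ʳ X₁) u₂ f₂ (≋-trans e (≋-prep _ e'))
...     | Q' , st , h = par P Q' , par-r st , λ {E} {K} fM →
  Up-≋ (A⟪ par P Q' ⟫ σ)
    (≋-trans (float-right K (left g _ 1 f) L₁ N') (B.++⁺ˡ K (B.++⁺ˡ (left g _ 1 f) (≋-sym t'))))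
    (Up-flat-↭ (A⟪ par P Q' ⟫ σ) (ids-right E X₁ s)
      (Up-par {A⟪ P ⟫ _} {A⟪ Q' ⟫ _} (done f₁) (h fM)))
reactA (par P Q) {σ} {g = g} {a} {f} {v} {M} inj av u (X₁ , X₂ , L₁ , L₂ , f₁ , f₂ , s , r') r
  | inj₂ (N , e , t) | inj₁ (N' , e' , t')
  with receives Q f₂ e | sends P f₁ e'
... | hidden y∈ refl | hidden x∈ refl = ⊥-elim (dis x∈ y∈)
... | hidden x∈ refl | free {b'} _ b≡ _ _ = ⊥-elim (av (PermP.∈-resp-↭ s (∈-++⁺ʳ X₁ x∈)) b' b≡)
... | hidden x∈ refl | bound {b'} _ b≡ _ _ _ = ⊥-elim (av (PermP.∈-resp-↭ s (∈-++⁺ʳ X₁ x∈)) b' b≡)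
... | visible {b'} _ b≡ _ | hidden x∈ refl = ⊥-elim (av (PermP.∈-resp-↭ s (∈-++⁺ˡ x∈)) b' b≡)
... | visible {b} {Q'} st refl h | free {b'} {c} {P'} st' b≡ refl fl with inj b' b b≡
...   | refl = par P' (sub1 Q' c) , comm-l st' st , λ {E} {K} fM →
  Up-≋ (A⟪ par P' (sub1 Q' c) ⟫ σ)
    (≋-trans (float-right K (left g _ 1 f) N' N) (B.++⁺ˡ K (B.++⁺ˡ (left g _ 1 f) (≋-sym t'))))
    (Up-flat-↭ (A⟪ par P' (sub1 Q' c) ⟫ σ) (ids-right E X₁ s)
      (Up-par {A⟪ P' ⟫ _} {A⟪ sub1 Q' c ⟫ _} (done fl) (Up-map (flat-~ (~-sym (A⟪⟫-sub1 Q' c))) (h fM))))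
reactA (par P Q) {σ} {g = g} {a} {f} {v} {M} inj av u (X₁ , X₂ , L₁ , L₂ , f₁ , f₂ , s , r') r
  | inj₂ (N , e , t) | inj₁ (N' , e' , t')
  | visible {b} {Q'} st refl h | bound {b'} {P'} {x} {X'} st' b≡ refl s' fl with inj b' b b≡
...   | refl = nu (par P' Q') , close-l st' st , λ {E} {K} fM →
  Up-≋ (A⟪ nu (par P' Q') ⟫ σ)
    (≋-trans (float-right K (left g _ 1 f) N' N) (B.++⁺ˡ K (B.++⁺ˡ (left g _ 1 f) (≋-sym t'))))
    (Up-flat-↭ (A⟪ nu (par P' Q') ⟫ σ)
      (↭-trans (PermP.++⁺ʳ (E ++ X₂) s') (ids-right E X₁ s))
      (Up-new {λ x → A⟪ par P' Q' ⟫ (outN x ▸ σ)}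
        (Up-par {A⟪ P' ⟫ _} {A⟪ Q' ⟫ _} (done fl) (h fM))))

A-react : ∀ {P : Proc 0} {k L g a f v M} → Alive (A⟪ P ⟫ ∅) k L → L ≋ preA g a 1 f ∷ sendA a (v ∷ []) ∷ M →
          ∀ {k' E N} → Alloc k k' E → Flat (f (v ∷ [])) E N →
          ∃₂ λ P' k'' → Step P τ P' × Alive (A⟪ P' ⟫ ∅) k'' (N ++ left g a 1 f ++ M)
A-react {P} (alive u b fl) r al fN
  with reactA P (λ { (sn _) (sn _) refl → refl ; ⋆ ⋆ refl → refl }) (λ { _ (sn _) () ; _ ⋆ () }) u fl r
... | P' , st , h with alive-alloc {A⟪ P' ⟫ ∅} u b al (h fN)
... | k'' , al' = P' , k'' , st , al'

A-success : ∀ {P : Proc 0} {k w L M} → Alive (A⟪ P ⟫ ∅) k L → L ≋ sendA (succN w) (star ∷ []) ∷ M →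
            ∃ λ P' → Step P (outA (sn w) ⋆) P' × Alive (A⟪ P' ⟫ ∅) k M
A-success {P} (alive u b fl) r with sends P fl r
... | free {sn _} {⋆} st refl refl fl' = _ , st , alive u b fl'

-- The encoding

pattern idA n   = 0 , 0 , n
pattern idB n   = 1 , 0 , n
pattern idC n   = 2 , 0 , n
-- The reply channel of a request records the channel n on which the request is made.
pattern idZ n z = 3 , n , z
pattern idD d   = 4 , 0 , d

manager : Id → Vec Name 2 → Sem
manager c (a ∷ b ∷ []) = pre once a 1 λ xs → pre once b 1 λ ys →
  send (outN c) (a ∷ b ∷ []) ∥ send (Vec.head ys) (Vec.head xs ∷ [])

request : Name → (Vec Name 1 → Sem) → Sem
request b body = new λ z → send b (outN z ∷ []) ∥ pre once (inN z) 1 body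

serve : Id → Name → (Vec Name 1 → Sem) → Vec Name 1 → Sem
serve d b body _ = send (outN d) (star ∷ []) ∥ request b body

-- F maps a name to the channel on which its inputs are requested (the map f of the encoding).
E⟪_⟫ : ∀ {n} → Proc n → NEnv n → NEnv n → Sem
E⟪ nil ⟫     σ F = 𝟎
E⟪ par P Q ⟫ σ F = E⟪ P ⟫ σ F ∥ E⟪ Q ⟫ σ F
E⟪ out a c ⟫ σ F = send (aval σ a) (aval σ c ∷ [])
E⟪ inp a P ⟫ σ F = request (aval F a) λ vs → E⟪ P ⟫ (Vec.head vs ▸ σ) (Vec.head vs ▸ F)
E⟪ rep a P ⟫ σ F = new λ d → send (outN d) (star ∷ []) ∥
  pre many (inN d) 1 (serve d (aval F a) λ vs → E⟪ P ⟫ (Vec.head vs ▸ σ) (Vec.head vs ▸ F))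
E⟪ nu P ⟫    σ F = new λ a → new λ b → new λ c →
  E⟪ P ⟫ (outN a ▸ σ) (outN b ▸ F) ∥
  send (outN c) (inN a ∷ inN b ∷ []) ∥ pre many (inN c) 2 (manager c)

wval-wwkV : ∀ {n} k {η : NEnv n} {η' : NEnv (k + n)} → (∀ i → η' (k ↑ʳ i) ≡ η i) →
            ∀ a → wval η' (wwkV k a) ≡ wval η a
wval-wwkV k h (wvar i) = h i
wval-wwkV k h (wsn w)  = refl
wval-wwkV k h w⋆       = refl

Decodes : ∀ {n m} → NEnv m → Env n m → NEnv n → Set
Decodes η ρ σ = ∀ i → wval η (ρ i) ≡ σ i

decodes-trV : ∀ {n m} {η : NEnv m} {ρ : Env n m} {σ} → Decodes η ρ σ → ∀ a → wval η (trV ρ a) ≡ aval σ a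
decodes-trV h (var i) = h i
decodes-trV h (sn w)  = refl
decodes-trV h ⋆       = refl

decodes-fV : ∀ {n m} {η : NEnv m} {ρ f : Env n m} {F} → Decodes η f F → ∀ a → wval η (fV ρ f a) ≡ aval F a
decodes-fV h (var i) = h i
decodes-fV h (sn w)  = refl
decodes-fV h ⋆       = refl

decodes-wk : ∀ {n m} k (ρ : Env n m) {η : NEnv m} {η' : NEnv (k + m)} {σ} → (∀ i → η' (k ↑ʳ i) ≡ η i) →
             Decodes η ρ σ → Decodes η' (λ i → wwkV k (ρ i)) σ
decodes-wk k ρ e h i = trans (wval-wwkV k e (ρ i)) (h i)

mutual
  -- Removes the de Bruijn arithmetic of the encoding. The shifts count the binders crossed: three
  -- for a restricted pair and an input parameter, six for the three restricted pairs of a `nu`.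
  enc~ : ∀ {n m} (P : Proc n) {ρ f : Env n m} {η σ F} → Decodes η ρ σ → Decodes η f F →
         W⟪ enc ρ f P ⟫ η ~ E⟪ P ⟫ σ F
  enc~ nil h j = 𝟎~
  enc~ (par P Q) h j = par~ (enc~ P h j) (enc~ Q h j)
  enc~ (out a c) {ρ} {f} {η} {σ} h j
    rewrite decodes-trV {η = η} {ρ} {σ} h a | decodes-trV {η = η} {ρ} {σ} h c = send~
  enc~ (inp a P) h j = encInp~ a P h j
  enc~ (rep a P) {ρ} {f} h j = new~ λ d → par~ send~ (pre~ λ { (u ∷ []) → par~ send~
    (encInp~ a P (decodes-wk 3 ρ (λ _ → refl) h) (decodes-wk 3 f (λ _ → refl) j)) })
  enc~ (nu P) {ρ} {f} h j = new~ λ a → new~ λ b → new~ λ c → par~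
    (enc~ P (λ { zero → refl ; (suc i) → decodes-wk 6 ρ (λ _ → refl) h i })
            (λ { zero → refl ; (suc i) → decodes-wk 6 f (λ _ → refl) j i }))
    (par~ send~ (pre~ λ { (a' ∷ b' ∷ []) → pre~ λ { (x ∷ []) → pre~ λ { (y ∷ []) → par~ send~ send~ } } }))

  encInp~ : ∀ {n m} (a : Val n) P {ρ f : Env n m} {η σ F} → Decodes η ρ σ → Decodes η f F →
            W⟪ encInp ρ f a P ⟫ η ~ request (aval F a) λ vs → E⟪ P ⟫ (Vec.head vs ▸ σ) (Vec.head vs ▸ F)
  encInp~ a P {ρ} {f} {η} {σ} {F} h j = new~ λ z →
    subst (λ b → send (wval _ (wwkV 2 (fV ρ f a))) (outN z ∷ []) ∥ _ ~ send b (outN z ∷ []) ∥ _)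
      (trans (wval-wwkV 2 {η} (λ _ → refl) (fV ρ f a)) (decodes-fV {ρ = ρ} {f} j a))
      (par~ send~ (pre~ λ { (v ∷ []) →
        enc~ P (λ { zero → refl ; (suc i) → decodes-wk 3 ρ (λ _ → refl) h i })
               (λ { zero → refl ; (suc i) → decodes-wk 3 f (λ _ → refl) j i }) }))

-- Joint flattening of typed processes and their encodings

-- The names that processes exchange. Request, manager, reply and token channels are excluded, so in
-- `outcome` a plain output can only meet a manager that is ready for a message.
data Good : Name → Set where
  good-star  : Good star
  good-succN : ∀ {w} → Good (succN w)
  good-outN  : ∀ {n} → Good (outN (idA n))

-- `C` delimits the channels that may be referred to, in `Encoded` those with a manager present. The
-- shared number `n` ties the request channel b to the message channel a.
record EnvOK (C : ℕ → Set) {m} (Γ : Ctx m) (σ F : NEnv m) : Set where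
  constructor mkEnvOK
  field
    good  : ∀ i → Good (σ i)
    chans : ∀ {i T} → lookup Γ i ≡ chan T → ∃ λ n → C n × σ i ≡ outN (idA n) × F i ≡ outN (idB n)

envOK-map : ∀ {C D m} {Γ : Ctx m} {σ F} → (∀ {n} → C n → D n) → EnvOK C Γ σ F → EnvOK D Γ σ F
envOK-map h (mkEnvOK gd ch) = mkEnvOK gd λ e → let n , c , es = ch e in n , h c , es

envOK-rcv : ∀ {C m} {Γ : Ctx m} {σ F T v} → Good v → EnvOK C Γ σ F → EnvOK C (rcv T ∷ Γ) (v ▸ σ) (v ▸ F)
envOK-rcv gv (mkEnvOK gd ch) = mkEnvOK (λ { zero → gv ; (suc i) → gd i }) λ { {zero} () ; {suc i} e → ch e }

envOK-chan : ∀ {C m} {Γ : Ctx m} {σ F T n} → C n → EnvOK C Γ σ F →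
             EnvOK C (chan T ∷ Γ) (outN (idA n) ▸ σ) (outN (idB n) ▸ F)
envOK-chan c (mkEnvOK gd ch) = mkEnvOK (λ { zero → good-outN ; (suc i) → gd i })
  λ { {zero} _ → _ , c , refl , refl ; {suc i} e → ch e }

good-aval : ∀ {C m} {Γ : Ctx m} {σ F} → EnvOK C Γ σ F → ∀ a → Good (aval σ a)
good-aval ok (var i) = EnvOK.good ok i
good-aval ok (sn w)  = good-succN
good-aval ok ⋆       = good-star

-- A continuation is kept as typed syntax with its environments, so that both of its interpretations
-- remain available until the argument arrives.
record Thunk (C : ℕ → Set) : Set where
  constructor thunk
  field
    {m}   : ℕ
    {Γ}   : Ctx m
    {T}   : VTy
    B     : Proc (suc m)
    σ F   : NEnv m
    typed : (rcv T ∷ Γ) ⊢ B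
    ok    : EnvOK C Γ σ F

  bodyA bodyE : Vec Name 1 → Sem
  bodyA vs = A⟪ B ⟫ (Vec.head vs ▸ σ)
  bodyE vs = E⟪ B ⟫ (Vec.head vs ▸ σ) (Vec.head vs ▸ F)

open Thunk using (bodyA; bodyE)

thunk-map : ∀ {C D} → (∀ {n} → C n → D n) → Thunk C → Thunk D
thunk-map h (thunk B σ F ty ok) = thunk B σ F ty (envOK-map h ok)

managerA idleA : ℕ → Atom
managerA n = preA many (inN (idC n)) 2 (manager (idC n))
idleA n    = sendA (outN (idC n)) (inN (idA n) ∷ inN (idB n) ∷ [])

requestA : ℕ → ℕ → Atom
requestA n z = sendA (outN (idB n)) (outN (idZ n z) ∷ [])

waitA : ∀ {C} → ℕ → ℕ → Thunk C → Atom
waitA n z t = preA once (inN (idZ n z)) 1 (bodyE t)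

tokenA : ℕ → Atom
tokenA d = sendA (outN (idD d)) (star ∷ [])

serverA : ∀ {C} → ℕ → ℕ → Thunk C → Atom
serverA d n t = preA many (inN (idD d)) 1 (serve (idD d) (outN (idB n)) (bodyE t))

inputA : ∀ {C} → Guard → ℕ → Thunk C → Atom
inputA g n t = preA g (outN (idA n)) 1 (bodyA t)

managers : List ℕ → Bag
managers []       = []
managers (n ∷ ns) = managerA n ∷ idleA n ∷ managers ns

-- On the left the atoms of AWπ other than the managers, on the right those of ALπ. No protocol run
-- is in progress: no message is held and no request has been granted.
data Settled (C : ℕ → Set) : Bag → Bag → Set where
  []     : Settled C [] []
  output : ∀ {a v L M} → Good a → Good v → Settled C L M →
           Settled C (sendA a (v ∷ []) ∷ L) (sendA a (v ∷ []) ∷ M)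
  input  : ∀ {n L M} → C n → ∀ z (t : Thunk C) → Settled C L M →
           Settled C (requestA n z ∷ waitA n z t ∷ L) (inputA once n t ∷ M)
  server : ∀ {n L M} → C n → ∀ d (t : Thunk C) → Settled C L M →
           Settled C (tokenA d ∷ serverA d n t ∷ L) (inputA many n t ∷ M)

settled-map : ∀ {C D L M} → (∀ {n} → C n → D n) → Settled C L M → Settled D L M
settled-map h []             = []
settled-map h (output a v s) = output a v (settled-map h s)
settled-map h (input c z t s)  = input (h c) z (thunk-map h t) (settled-map h s)
settled-map h (server c d t s) = server (h c) d (thunk-map h t) (settled-map h s)

settled-++ : ∀ {C L M L' M'} → Settled C L M → Settled C L' M' → Settled C (L ++ L') (M ++ M')
settled-++ []               s' = s'
settled-++ (output a v s)   s' = output a v (settled-++ s s')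
settled-++ (input c z t s)  s' = input c z t (settled-++ s s')
settled-++ (server c d t s) s' = server c d t (settled-++ s s')

-- Process and encoding are flattened together, so that a restriction gets the same `idA` on both
-- sides. The channels created on the way are listed in `ns`, and their managers are kept apart from
-- `L`.
record Flattening (C : ℕ → Set) {m} (P : Proc m) (σ F : NEnv m) (k : ℕ) : Set where
  constructor mkFlattening
  field
    {k'}    : ℕ
    {E E'}  : Ids
    ns      : List ℕ
    {L M}   : Bag
    alloc   : Alloc k k' E
    alloc'  : Alloc k k' E'
    flatE   : Flat (E⟪ P ⟫ σ F) E (managers ns ++ L)
    flatA   : Flat (A⟪ P ⟫ σ) E' M
    settled : Settled (λ n → n ∈ ns ⊎ C n) L M

alloc-[] : ∀ {k k'} → k ≤ k' → Alloc k k' []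
alloc-[] l = mkAlloc l [] []

alloc-one : ∀ {k} x → num x ≡ k → Alloc k (suc k) (x ∷ [])
alloc-one x refl = mkAlloc (ℕP.n≤1+n _) ([] ∷ []) ((ℕP.≤-refl , ℕP.≤-refl) ∷ [])

managers-++ : ∀ ns ns' → managers (ns ++ ns') ≡ managers ns ++ managers ns'
managers-++ []       ns' = refl
managers-++ (n ∷ ns) ns' = cong (λ L → managerA n ∷ idleA n ∷ L) (managers-++ ns ns')

module _ where
  open BS using (solve; _⊜_; _⊕_)

  opaque
    interchange : ∀ A B C D → (A ++ B) ++ C ++ D ≋ (A ++ C) ++ B ++ D
    interchange = solve 4 (λ a b c d → (a ⊕ b) ⊕ c ⊕ d ⊜ (a ⊕ c) ⊕ b ⊕ d) ≋-refl

    reverse₃ : ∀ A B C → (A ++ B ++ C) ≋ C ++ B ++ A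
    reverse₃ = solve 3 (λ a b c → a ⊕ b ⊕ c ⊜ c ⊕ b ⊕ a) ≋-refl

flat-input : ∀ {a b} g f → a ≡ b → Flat (pre g a 1 f) [] [ preA g b 1 f ]
flat-input g f refl = ≋-refl

flat-request : ∀ {a b} x f → a ≡ b → Flat (request a f) [ x ] (sendA b (outN x ∷ []) ∷ preA once (inN x) 1 f ∷ [])
flat-request x f refl = x , [] , ([] , [] , _ , _ , ≋-refl , ≋-refl , ↭-refl , ≋-refl) , ↭-refl

flat-server : ∀ {a b} d f → a ≡ b →
              Flat (new λ d → send (outN d) (star ∷ []) ∥ pre many (inN d) 1 (serve d a f)) [ d ]
                   (sendA (outN d) (star ∷ []) ∷ preA many (inN d) 1 (serve d b f) ∷ [])
flat-server d f refl = d , [] , ([] , [] , _ , _ , ≋-refl , ≋-refl , ↭-refl , ≋-refl) , ↭-refl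

managers-interchange : ∀ ns ns' {L₁ L₂} →
  managers (ns ++ ns') ++ L₁ ++ L₂ ≋ (managers ns ++ L₁) ++ managers ns' ++ L₂
managers-interchange ns ns' {L₁} {L₂} rewrite managers-++ ns ns' =
  interchange (managers ns) (managers ns') L₁ L₂

flatten : ∀ {C m} {Γ : Ctx m} {P σ F} → Γ ⊢ P → EnvOK C Γ σ F → ∀ k → Flattening C P σ F k
flatten tnil ok k = mkFlattening [] (alloc-[] ℕP.≤-refl) (alloc-[] ℕP.≤-refl) ≋-refl ≋-refl []
flatten {P = par P Q} {σ} {F} (tpar p q) ok k with flatten p ok k
... | mkFlattening {k₁} {E₁} {E₁'} ns {L₁} {M₁} a a' fE fA s with flatten q ok k₁
... | mkFlattening {k₂} {E₂} {E₂'} ns' {L₂} {M₂} b b' fE' fA' s' =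
  mkFlattening (ns ++ ns') (alloc-++ a b) (alloc-++ a' b')
    (E₁ , E₂ , _ , _ , fE , fE' , ↭-refl , managers-interchange ns ns')
    (E₁' , E₂' , _ , _ , fA , fA' , ↭-refl , ≋-refl)
    (settled-++ (settled-map [ inj₁ ∘ ∈-++⁺ˡ , inj₂ ]′ s) (settled-map [ inj₁ ∘ ∈-++⁺ʳ ns , inj₂ ]′ s'))
flatten {P = out a c} {σ} (tout _ _) ok k =
  mkFlattening [] (alloc-[] ℕP.≤-refl) (alloc-[] ℕP.≤-refl) ≋-refl ≋-refl
    (output (good-aval ok a) (good-aval ok c) [])
flatten {P = inp (var i) P} {σ} {F} (tinp e p) ok k with EnvOK.chans ok e
... | n , c , σ≡ , F≡ =
  mkFlattening [] (alloc-one (idZ n k) refl) (alloc-[] (ℕP.n≤1+n k))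
    (flat-request (idZ n k) _ F≡) (flat-input once _ σ≡)
    (input (inj₂ c) k (thunk P σ F p (envOK-map inj₂ ok)) [])
flatten {P = rep (var i) P} {σ} {F} (trep e p) ok k with EnvOK.chans ok e
... | n , c , σ≡ , F≡ =
  mkFlattening [] (alloc-one (idD k) refl) (alloc-[] (ℕP.n≤1+n k))
    (flat-server (idD k) _ F≡) (flat-input many _ σ≡)
    (server (inj₂ c) k (thunk P σ F p (envOK-map inj₂ ok)) [])
flatten {C} {P = nu P} (tnu p) ok k
  -- Under the restriction, channel `k` counts as given from outside; it joins `ns` only in the
  -- result, where `settled-map` reclassifies it.
  with flatten p (envOK-chan {C = λ n → n ≡ k ⊎ C n} (inj₁ refl) (envOK-map inj₂ ok)) (suc k)
... | mkFlattening {k₁} {E₁} {E₁'} ns {L} {M} a a' fE fA s =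
  mkFlattening (k ∷ ns) (alloc-++ three a) (alloc-++ (alloc-one (idA k) refl) a')
    (idA k , _ , (idB k , _ , (idC k , _ ,
      (E₁ , [] , _ , _ , fE , ([] , [] , _ , _ , ≋-refl , ≋-refl , ↭-refl , ≋-refl) ,
        PermP.++-identityʳ E₁ , reverse₃ [ managerA k ] [ idleA k ] (managers ns ++ L)) ,
      ↭-refl) , ↭-refl) , ↭-refl)
    (idA k , E₁' , fA , ↭-refl)
    (settled-map (λ { (inj₁ q) → inj₁ (there q) ; (inj₂ (inj₁ refl)) → inj₁ (here refl)
                    ; (inj₂ (inj₂ c)) → inj₂ c }) s)
  where
  three : Alloc k (suc k) (idA k ∷ idB k ∷ idC k ∷ [])
  three = mkAlloc (ℕP.n≤1+n k)
    (((λ ()) ∷ (λ ()) ∷ []) ∷ ((λ ()) ∷ []) ∷ [] ∷ [])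
    (bnd ∷ bnd ∷ bnd ∷ [])
    where
    bnd : k ≤ k × k < suc k
    bnd = ℕP.≤-refl , ℕP.≤-refl

flatten-body : ∀ {C v} (t : Thunk C) → Good v → ∀ k → Flattening C (Thunk.B t) (v ▸ Thunk.σ t) (v ▸ Thunk.F t) k
flatten-body t gv = flatten (Thunk.typed t) (envOK-rcv gv (Thunk.ok t))

-- ALπ simulates the encoding

-- In this direction the manager concerned appears in the reduction to be matched, so no record of
-- existing channels is kept.
Anywhere : ℕ → Set
Anywhere _ = ⊤

-- Evidence that a copy unfolded in AWπ can still be answered in ALπ: the replicated input it came
-- from remains in the multiset.
record Persists (L : Bag) (n : ℕ) (t : Thunk Anywhere) : Set where
  constructor persists
  field
    {others} : Bag
    present  : L ≋ inputA many n t ∷ others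

persists-≋ : ∀ {L M n t} → L ≋ M → Persists L n t → Persists M n t
persists-≋ r (persists e) = persists (≋-trans (≋-sym r) e)

persists-++ : ∀ M {L n t} → Persists L n t → Persists (M ++ L) n t
persists-++ M (persists {K} e) = persists (≋-trans (B.++⁺ˡ M e) (B.↭-shift M K))

NotMany : Atom → Set
NotMany x = ∀ {n} {t : Thunk Anywhere} → x ≈ₐ inputA many n t → ⊥

persists-tail : ∀ {x L n t} → NotMany x → Persists (x ∷ L) n t → Persists L n t
persists-tail {x} {t = t} nm (persists e) with split-≋ [ x ] e
... | inj₁ (_ , e' , _) = ⊥-elim (nm {t = t} (proj₁ (singleton-≋ e')))
... | inj₂ (_ , e' , _) = persists e'

handOver : ℕ → Name → Name → Sem
handOver n v y = send (outN (idC n)) (inN (idA n) ∷ inN (idB n) ∷ []) ∥ send y (v ∷ [])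

readyA : ℕ → Atom
readyA n = preA once (inN (idA n)) 1 λ xs → pre once (inN (idB n)) 1 λ ys → handOver n (Vec.head xs) (Vec.head ys)

holdA : ℕ → Name → Atom
holdA n v = preA once (inN (idB n)) 1 λ ys → handOver n v (Vec.head ys)

messageA : ℕ → Name → Atom
messageA n v = sendA (outN (idA n)) (v ∷ [])

grantA : ℕ → ℕ → Name → Atom
grantA n z v = sendA (outN (idZ n z)) (v ∷ [])

-- The messages and inputs of ALπ that an atom of AWπ stands for.  A message counts as pending until
-- it has been delivered on the reply channel, also when it is held by the manager or granted.
-- R collects the replicated inputs, of which there may be unfolded copies.
data Item (R : ℕ → Thunk Anywhere → Set) : Atom → Bag → Set where
  managing  : ∀ n → Item R (managerA n) []
  idle      : ∀ n → Item R (idleA n) []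
  ready     : ∀ n → Item R (readyA n) []
  hold      : ∀ n {v} → Good v → Item R (holdA n v) [ messageA n v ]
  output    : ∀ {a v} → Good a → Good v → Item R (sendA a (v ∷ [])) [ sendA a (v ∷ []) ]
  requested : ∀ n z → Item R (requestA n z) []
  grant     : ∀ n z {v} → Good v → Item R (grantA n z v) [ messageA n v ]
  wait      : ∀ n z (t : Thunk Anywhere) → Item R (waitA n z t) [ inputA once n t ]
  wait-copy : ∀ n z t → R n t → Item R (waitA n z t) []
  token     : ∀ d → Item R (tokenA d) []
  server    : ∀ d n (t : Thunk Anywhere) → Item R (serverA d n t) [ inputA many n t ]

data Items (R : ℕ → Thunk Anywhere → Set) : Bag → Bag → Set where
  []  : Items R [] []
  _∷_ : ∀ {x A L M} → Item R x A → Items R L M → Items R (x ∷ L) (A ++ M)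

item-map : ∀ {R S x A} → (∀ {n t} → R n t → S n t) → Item R x A → Item S x A
item-map h (managing n)        = managing n
item-map h (idle n)            = idle n
item-map h (ready n)           = ready n
item-map h (hold n v)          = hold n v
item-map h (output a v)        = output a v
item-map h (requested n z)     = requested n z
item-map h (grant n z v)       = grant n z v
item-map h (wait n z t)        = wait n z t
item-map h (wait-copy n z t r) = wait-copy n z t (h r)
item-map h (token d)           = token d
item-map h (server d n t)      = server d n t

items-map : ∀ {R S L M} → (∀ {n t} → R n t → S n t) → Items R L M → Items S L M
items-map h []       = []
items-map h (i ∷ is) = item-map h i ∷ items-map h is

items-++ : ∀ {R L M L' M'} → Items R L M → Items R L' M' → ∃ λ N → Items R (L ++ L') N × N ≋ M ++ M'
items-++ [] js = _ , js , ≋-refl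
items-++ {M' = M'} (_∷_ {A = A} {M = M} i is) js with items-++ is js
... | N , ks , e = A ++ N , i ∷ ks , ≋-trans (B.++⁺ˡ A e) (≋-sym (B.++-assoc A M M'))

items-managers : ∀ {R} ns → Items R (managers ns) []
items-managers []       = []
items-managers (n ∷ ns) = managing n ∷ idle n ∷ items-managers ns

settled⇒items : ∀ {R L M} → Settled Anywhere L M → Items R L M
settled⇒items []               = []
settled⇒items (output a v s)   = output a v ∷ settled⇒items s
settled⇒items (input {n} _ z t s)  = requested n z ∷ wait n z t ∷ settled⇒items s
settled⇒items (server {n} _ d t s) = token d ∷ server d n t ∷ settled⇒items s

items-pick : ∀ {R L M x L'} → Items R L M → Pick x L L' →
             ∃₂ λ A M' → Item R x A × Items R L' M' × M ≋ A ++ M'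
items-pick (i ∷ is) here = _ , _ , i , is , ≋-refl
items-pick (_∷_ {A = A} i is) (there p) with items-pick is p
... | A' , M' , j , js , e = A' , A ++ M' , j , i ∷ js , ≋-trans (B.++⁺ˡ A e) (B.shifts A A')

-- `silent` covers the first three protocol steps and the unfolding of a replicated input, where
-- reactants and products stand for the same atoms of ALπ. `fires` is the delivery on the reply
-- channel, received either by a single input or by an unfolded copy, which itself stands for
-- nothing.
data Outcome (R : ℕ → Thunk Anywhere → Set) (g : Guard) (x : Id) (k : ℕ) (f : Vec Name k → Sem)
             (vs : Vec Name k) (A A' : Bag) : Set where
  silent : ∀ {L K N} → Flat° (f vs) L → left g (inN x) k f ≋ K → Items R (L ++ K) N → N ≋ A ++ A' →
           Outcome R g x k f vs A A'
  fires  : ∀ {n v} (t : Thunk Anywhere) → g ≡ once → Good v → bodyE t (v ∷ []) ≈ f vs →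
           (A ≡ [ inputA once n t ]) ⊎ (A ≡ [] × R n t) → A' ≡ [ messageA n v ] →
           Outcome R g x k f vs A A'

-- The label of a channel's identifier determines the partner: each of the six kinds of input item
-- can meet just one kind of output item. A reply channel records `n`, so whichever waiting input
-- receives a grant, message and input belong to the same channel of ALπ. The first hypothesis
-- records the replicated input for the copy that a server creates.
outcome : ∀ {R g x k f} {vs : Vec Name k} {y y' A A'} → (∀ {n t} → A ≡ [ inputA many n t ] → R n t) →
          Item R y A → y ≈ₐ preA g (inN x) k f → Item R y' A' → y' ≈ₐ sendA (outN x) vs →
          Outcome R g x k f vs A A'
outcome h (managing n) (pre≈ₐ e) (idle _) send≈ₐ =
  silent (flat°-≈ (e _) (flat° {ids = []} ≋-refl)) (≋-cons (≈ₐ-sym (pre≈ₐ e)) ≋-refl)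
    (ready n ∷ managing n ∷ []) ≋-refl
outcome h (ready n) (pre≈ₐ e) (output _ gv) send≈ₐ =
  silent (flat°-≈ (e _) (flat° {ids = []} ≋-refl)) ≋-refl (hold n gv ∷ []) ≋-refl
outcome h (hold n gv) (pre≈ₐ e) (requested _ z) send≈ₐ =
  silent (flat°-≈ (e _) (flat°-par (flat° {ids = []} ≋-refl) (flat° {ids = []} ≋-refl))) ≋-refl
    (idle n ∷ grant n z gv ∷ []) ≋-refl
outcome h (wait n z t) (pre≈ₐ e) (grant _ _ gv) send≈ₐ =
  fires t refl gv (e _) (inj₁ refl) refl
outcome h (wait-copy n z t r) (pre≈ₐ e) (grant _ _ gv) send≈ₐ =
  fires t refl gv (e _) (inj₂ (refl , r)) refl
-- Reply channels need not be distinct in this direction, hence the number 0.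
outcome h (server d n t) (pre≈ₐ e) (token _) send≈ₐ =
  silent (flat°-≈ (e _) (flat°-par (flat° {ids = []} ≋-refl) (flat° (flat-request (idZ n 0) _ refl))))
    (≋-cons (≈ₐ-sym (pre≈ₐ e)) ≋-refl)
    (token d ∷ requested n 0 ∷ wait-copy n 0 t (h refl) ∷ server d n t ∷ []) ≋-refl

record Decoded (W : WProc 0) (P : Proc 0) : Set where
  constructor mkDecoded
  field
    {k}   : ℕ
    {L M} : Bag
    flatW : Flat° (W⟪ W ⟫ ∅) L
    flatA : Alive (A⟪ P ⟫ ∅) k M
    items : Items (Persists M) L M

decoded-intro : ∀ {W P k L M K N} → Flat° (W⟪ W ⟫ ∅) L → Alive (A⟪ P ⟫ ∅) k M →
                Items (Persists M) K N → L ≋ K → N ≋ M → Decoded W P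
decoded-intro fW fA is r s =
  mkDecoded (flat°-≋ r fW) (alive-≋ (≋-sym s) fA) (items-map (persists-≋ (≋-sym s)) is)

-- If a copy receives the message, the persistent replicated input reacts in its place: the guard in
-- ALπ is then `many`, although a `once` prefix fired in AWπ. No replicated input is lost, so all
-- evidence of persistence survives.
source : ∀ {M n v A A' M'} (t : Thunk Anywhere) → (A ≡ [ inputA once n t ]) ⊎ (A ≡ [] × Persists M n t) →
         A' ≡ [ messageA n v ] → M ≋ A ++ A' ++ M' →
         ∃₂ λ g K → M ≋ inputA g n t ∷ messageA n v ∷ K × left g (outN (idA n)) 1 (bodyA t) ++ K ≋ M'
                  × (∀ {m u} → Persists M m u → Persists M' m u)
source t (inj₁ refl) refl r = once , _ , r , ≋-refl ,
  λ p → persists-tail (λ ()) (persists-tail (λ ()) (persists-≋ r p))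
source {n = n} {v} t (inj₂ (refl , persists s)) refl r with split-≋ [ messageA n v ] (≋-trans (≋-sym r) s)
... | inj₁ (_ , e , _) with singleton-≋ e
...   | () , _
source {n = n} {v} t (inj₂ (refl , persists s)) refl r | inj₂ (N , e , e') =
  many , N , ≋-trans s (≋-prep _ e') , ≋-sym e , λ p → persists-tail (λ ()) (persists-≋ r p)

decoded-τ : ∀ {W W' P} → Decoded W P → W ⟶ W' → ∃ λ P' → τ⇒ ALπ P P' × Decoded W' P'
decoded-τ {W' = W'} {P} (mkDecoded {k} {L} {M} fW fA is) st with ⟶-flat st fW
... | x , mkComm g l f vs L₀ eq , h with pick-≋ eq
... | y , L₁ , p₁ , e₁ , r₁ with pick-≋ r₁
... | y' , L₂ , p₂ , e₂ , r₂ with items-pick is p₁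
... | A , M₁ , i , is₁ , s₁ with items-pick is₁ p₂
... | A' , M₂ , i' , is₂ , s₂
  with outcome (λ { refl → persists s₁ }) i e₁ i' e₂ | ≋-trans s₁ (B.++⁺ˡ A s₂)
... | silent {L'} {K} {N} fM lK js t | s with items-++ js is₂
...   | N' , ks , t' = P , ε ,
  decoded-intro (h fM) fA ks
    (≋-trans (B.++⁺ˡ L' (B.++⁺ lK (≋-sym r₂))) (≋-sym (B.++-assoc L' K L₂)))
    (≋-trans t' (≋-trans (B.++⁺ʳ M₂ t) (≋-trans (B.++-assoc A A' M₂) (≋-sym s))))
decoded-τ {W' = W'} {P} (mkDecoded {k} {L} {M} fW fA is) st
    | x , mkComm g l f vs L₀ eq , h | y , L₁ , p₁ , e₁ , r₁ | y' , L₂ , p₂ , e₂ , r₂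
    | A , M₁ , i , is₁ , s₁ | A' , M₂ , i' , is₂ , s₂
    | fires {n} {v} t refl gv b≈ src refl | s
  with source t src refl s | flatten-body t gv k
... | g' , K , sM , lK , per | mkFlattening ns {L'} {M'} _ al' flE flA set
  with A-react fA sM al' flA
     | items-++ (items-managers ns) (settled⇒items (settled-map (λ _ → tt) set))
... | P' , _ , st' , fA' | N , js , t₁ with items-++ js is₂
... | N' , ks , t₂ = P' , st' ◅ ε ,
  decoded-intro (h (flat°-≈ b≈ (flat° flE))) fA' (items-map (λ p → persists-++ M' (persists-≋ (≋-sym lK) (per p))) ks)
    (B.++⁺ˡ (managers ns ++ L') (≋-sym r₂))
    (≋-trans t₂ (B.++⁺ t₁ (≋-sym lK)))

decoded-ω : ∀ {W W' P w} → Decoded W P → WOut w W W' → ∃ λ P' → Step P (outA (sn w) ⋆) P' × Decoded W' P'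
decoded-ω (mkDecoded fW fA is) st with WOut-flat st fW
... | L₀ , r , fW' with pick-≋ r
... | y , L₁ , p , send≈ₐ , s with items-pick is p
... | _ , M₁ , output _ _ , is₁ , t with A-success fA t
... | P' , st' , fA' = P' , st' ,
  decoded-intro fW' fA' (items-map (λ q → persists-tail (λ ()) (persists-≋ t q)) is₁) (≋-sym s) ≋-refl

emptyOK : ∀ {C} → EnvOK C [] ∅ ∅
emptyOK = mkEnvOK (λ ()) λ { {()} }

flatten-closed : ∀ {C P} → [] ⊢ P → Flattening C P ∅ ∅ 0
flatten-closed ty = flatten ty emptyOK 0

enc∅~ : ∀ P → W⟪ ⟦ P ⟧∅ ⟫ ∅ ~ E⟪ P ⟫ ∅ ∅
enc∅~ P = enc~ P (λ ()) (λ ())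

encoding-simulated : ∀ P → [] ⊢ P → WeaklySimulates AWπ ALπ ⟦ P ⟧∅ P
encoding-simulated P ty = Decoded , sim , init
  where
  sim : IsWeakSim AWπ ALπ Decoded
  sim τo s st = decoded-τ s st
  sim (ωo w) s st with decoded-ω s st
  ... | P' , st' , s' = P' , (_ , _ , ε , st' , ε) , s'
  init : Decoded ⟦ P ⟧∅ P
  init with flatten-closed {Anywhere} ty
  ... | mkFlattening ns _ al' flE flA set
    with items-++ (items-managers ns) (settled⇒items (settled-map (λ _ → tt) set))
  ... | N , is , r =
    decoded-intro (flat° (flat-~ (~-sym (enc∅~ P)) flE))
      (alive (Alloc.unique al') (alloc⇒below al') flA)
      is ≋-refl r

-- The encoding simulates ALπ

-- `N` depends on `k₁` because the identifiers chosen for the body occur in its atoms.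
W-step : ∀ {W k L g x l f vs K} {N : ℕ → Bag} → Alive (W⟪ W ⟫ ∅) k L →
         L ≋ preA g (inN x) l f ∷ sendA (outN x) vs ∷ K →
         (∀ k₁ → ∃₂ λ k' E → Alloc k₁ k' E × Flat (f vs) E (N k₁)) →
         ∃₂ λ W' k' → ∃ λ k₁ → W ⟶ W' × Alive (W⟪ W' ⟫ ∅) k' (N k₁ ++ left g (inN x) l f ++ K)
W-step fW e flat with W-react fW (mkComm _ _ _ _ _ e)
... | k₁ , h with flat k₁
... | _ , _ , al , fl with h al fl
... | W' , k' , st , fW' = W' , k' , k₁ , st , fW'

module _ where
  open BS using (solve; _⊜_; _⊕_)

  opaque
    perm₁ : ∀ m c i r w K → m ++ c ++ i ++ r ++ w ++ K ≋ c ++ i ++ m ++ r ++ w ++ K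
    perm₁ = solve 6 (λ m c i r w K → m ⊕ c ⊕ i ⊕ r ⊕ w ⊕ K ⊜ c ⊕ i ⊕ m ⊕ r ⊕ w ⊕ K) ≋-refl

    perm₂ : ∀ y c m r w K → y ++ c ++ m ++ r ++ w ++ K ≋ y ++ m ++ c ++ r ++ w ++ K
    perm₂ = solve 6 (λ y c m r w K → y ⊕ c ⊕ m ⊕ r ⊕ w ⊕ K ⊜ y ⊕ m ⊕ c ⊕ r ⊕ w ⊕ K) ≋-refl

    perm₃ : ∀ h c r w K → h ++ c ++ r ++ w ++ K ≋ h ++ r ++ c ++ w ++ K
    perm₃ = solve 5 (λ h c r w K → h ⊕ c ⊕ r ⊕ w ⊕ K ⊜ h ⊕ r ⊕ c ⊕ w ⊕ K) ≋-refl

    perm₄ : ∀ i g c w K → i ++ g ++ c ++ w ++ K ≋ w ++ g ++ c ++ i ++ K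
    perm₄ = solve 5 (λ i g c w K → i ⊕ g ⊕ c ⊕ w ⊕ K ⊜ w ⊕ g ⊕ c ⊕ i ⊕ K) ≋-refl

opaque
  accept-message : ∀ {W k L n v K} → Alive (W⟪ W ⟫ ∅) k L → L ≋ readyA n ∷ messageA n v ∷ K →
                   ∃₂ λ W' k' → W ⟶ W' × Alive (W⟪ W' ⟫ ∅) k' (holdA n v ∷ K)
  accept-message {n = n} {v} fW e =
    let W' , k' , _ , st , fW' = W-step {N = λ _ → [ holdA n v ]} fW e
          (λ k → k , [] , alloc-[] ℕP.≤-refl , ≋-refl)
    in W' , k' , st , fW'

  activate : ∀ {W k L n K} → Alive (W⟪ W ⟫ ∅) k L → L ≋ managerA n ∷ idleA n ∷ K →
             ∃₂ λ W' k' → W ⟶ W' × Alive (W⟪ W' ⟫ ∅) k' (readyA n ∷ managerA n ∷ K)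
  activate {n = n} fW e =
    let W' , k' , _ , st , fW' = W-step {N = λ _ → [ readyA n ]} fW e
          (λ k → k , [] , alloc-[] ℕP.≤-refl , ≋-refl)
    in W' , k' , st , fW'

  accept-request : ∀ {W k L n v z K} → Alive (W⟪ W ⟫ ∅) k L → L ≋ holdA n v ∷ requestA n z ∷ K →
                   ∃₂ λ W' k' → W ⟶ W' × Alive (W⟪ W' ⟫ ∅) k' (idleA n ∷ grantA n z v ∷ K)
  accept-request {n = n} {v} {z} fW e =
    let W' , k' , _ , st , fW' = W-step {N = λ _ → idleA n ∷ grantA n z v ∷ []} fW e
          (λ k → k , [] , alloc-[] ℕP.≤-refl , [] , [] , _ , _ , ≋-refl , ≋-refl , ↭-refl , ≋-refl)
    in W' , k' , st , fW'

  accept-grant : ∀ {C W k L n v z} {t : Thunk C} {K} → Good v → Alive (W⟪ W ⟫ ∅) k L →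
                 L ≋ waitA n z t ∷ grantA n z v ∷ K →
                 ∃₂ λ W' k' → Σ[ k₁ ∈ ℕ ] Σ[ fl ∈ Flattening C (Thunk.B t) (v ▸ Thunk.σ t) (v ▸ Thunk.F t) k₁ ]
                   (W ⟶ W' × Alive (W⟪ W' ⟫ ∅) k' ((managers (Flattening.ns fl) ++ Flattening.L fl) ++ K))
  accept-grant {C} {v = v} {t = t} gv fW e =
    let W' , k' , k₁ , st , fW' = W-step {N = λ k → managers (ns (fl k)) ++ L (fl k)} fW e
          (λ k → _ , _ , alloc (fl k) , flatE (fl k))
    in W' , k' , k₁ , fl k₁ , st , fW'
    where
    open Flattening
    fl : ∀ k → Flattening C (Thunk.B t) (v ▸ Thunk.σ t) (v ▸ Thunk.F t) k
    fl = flatten-body t gv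

  spawn : ∀ {C W k L d n} {t : Thunk C} {K} → Alive (W⟪ W ⟫ ∅) k L → L ≋ serverA d n t ∷ tokenA d ∷ K →
          ∃₂ λ W' k' → ∃ λ z → W ⟶ W' ×
            Alive (W⟪ W' ⟫ ∅) k' (tokenA d ∷ requestA n z ∷ waitA n z t ∷ serverA d n t ∷ K)
  spawn {d = d} {n} {t} fW e =
    W-step {N = λ z → tokenA d ∷ requestA n z ∷ waitA n z t ∷ []} fW e
      -- The bound itself serves as the number of the new reply channel.
      (λ z → suc z , [ idZ n z ] , alloc-one (idZ n z) refl ,
         [] , [ idZ n z ] , _ , _ , ≋-refl , flat-request (idZ n z) _ refl , ↭-refl , ≋-refl)

opaque
  communicate : ∀ {C W k L n v z} {t : Thunk C} {K} → Good v → Alive (W⟪ W ⟫ ∅) k L →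
                L ≋ messageA n v ∷ managerA n ∷ idleA n ∷ requestA n z ∷ waitA n z t ∷ K →
                ∃₂ λ W' k' → Σ[ k₁ ∈ ℕ ] Σ[ fl ∈ Flattening C (Thunk.B t) (v ▸ Thunk.σ t) (v ▸ Thunk.F t) k₁ ]
                  (τ⇒ AWπ W W' ×
                   Alive (W⟪ W' ⟫ ∅) k' ((managers (Flattening.ns fl) ++ Flattening.L fl) ++ managerA n ∷ idleA n ∷ K))
  communicate {n = n} {v} {z} {t} {K} gv f₀ e
    with activate f₀ (≋-trans e (perm₁ [ messageA n v ] [ managerA n ] [ idleA n ] [ requestA n z ] [ waitA n z t ] K))
  ... | W₁ , _ , st₁ , f₁
    with accept-message f₁ (perm₂ [ readyA n ] [ managerA n ] [ messageA n v ] [ requestA n z ] [ waitA n z t ] K)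
  ... | W₂ , _ , st₂ , f₂
    with accept-request f₂ (perm₃ [ holdA n v ] [ managerA n ] [ requestA n z ] [ waitA n z t ] K)
  ... | W₃ , _ , st₃ , f₃
    with accept-grant {t = t} gv f₃ (perm₄ [ idleA n ] [ grantA n z v ] [ managerA n ] [ waitA n z t ] K)
  ... | W₄ , k₄ , k₁ , fl , st₄ , f₄ = W₄ , k₄ , k₁ , fl , st₁ ◅ st₂ ◅ st₃ ◅ st₄ ◅ ε , f₄

managers-∈ : ∀ {n ns} → n ∈ ns → ∃ λ K → managers ns ≋ managerA n ∷ idleA n ∷ K
managers-∈ (here refl) = _ , ≋-refl
managers-∈ {n} {m ∷ ns} (there p) with managers-∈ p
... | K , e = managerA m ∷ idleA m ∷ K ,
  ≋-trans (B.++⁺ˡ (managerA m ∷ idleA m ∷ []) e) (B.shifts (managerA m ∷ idleA m ∷ []) (managerA n ∷ idleA n ∷ []))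

data Source (C : ℕ → Set) : Bag → Atom → Set where
  output : ∀ {a v} → Good a → Good v → Source C [ sendA a (v ∷ []) ] (sendA a (v ∷ []))
  input  : ∀ {n} → C n → ∀ z (t : Thunk C) → Source C (requestA n z ∷ waitA n z t ∷ []) (inputA once n t)
  server : ∀ {n} → C n → ∀ d (t : Thunk C) → Source C (tokenA d ∷ serverA d n t ∷ []) (inputA many n t)

source∷settled : ∀ {C K x L M} → Source C K x → Settled C L M → Settled C (K ++ L) (x ∷ M)
source∷settled (output a v)   s = output a v s
source∷settled (input c z t)  s = input c z t s
source∷settled (server c d t) s = server c d t s

Picked : (C : ℕ → Set) → Atom → Bag → Bag → Set
Picked C x L M = ∃₂ λ K L' → Source C K x × Settled C L' M × L ≋ K ++ L'

settled-pick : ∀ {C L M x M'} → Settled C L M → Pick x M M' → Picked C x L M'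
settled-pick (output a v s)   here = _ , _ , output a v , s , ≋-refl
settled-pick (input c z t s)  here = _ , _ , input c z t , s , ≋-refl
settled-pick (server c d t s) here = _ , _ , server c d t , s , ≋-refl
settled-pick {C} s            (there p) = later s p
  where
  skip : ∀ {J x y L M} → Source C J y → Picked C x L M → Picked C x (J ++ L) (y ∷ M)
  skip {J} j (K , L' , k , s , e) = K , J ++ L' , k , source∷settled j s , ≋-trans (B.++⁺ˡ J e) (B.shifts J K)
  later : ∀ {L y M x M'} → Settled C L (y ∷ M) → Pick x M M' → Picked C x L (y ∷ M')
  later (output a v s)   p = skip (output a v) (settled-pick s p)
  later (input c z t s)  p = skip (input c z t) (settled-pick s p)
  later (server c d t s) p = skip (server c d t) (settled-pick s p)

record Encoded (P : Proc 0) (W : WProc 0) : Set where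
  constructor mkEncoded
  field
    {k}     : ℕ
    {ns}    : List ℕ
    {L M}   : Bag
    flatA   : Flat° (A⟪ P ⟫ ∅) M
    flatW   : Alive (W⟪ W ⟫ ∅) k (managers ns ++ L)
    settled : Settled (_∈ ns) L M

module _ where
  open BS using (solve; _⊜_; _⊕_)

  opaque
    expose : ∀ c i r w m K L → (c ++ i ++ K) ++ (r ++ w) ++ m ++ L ≋ m ++ c ++ i ++ r ++ w ++ K ++ L
    expose = solve 7 (λ c i r w m K L →
      (c ⊕ i ⊕ K) ⊕ (r ⊕ w) ⊕ m ⊕ L ⊜ m ⊕ c ⊕ i ⊕ r ⊕ w ⊕ K ⊕ L) ≋-refl

    collect : ∀ A B c i K L → (A ++ B) ++ c ++ i ++ K ++ L ≋ (A ++ c ++ i ++ K) ++ B ++ L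
    collect = solve 6 (λ A B c i K L → (A ⊕ B) ⊕ c ⊕ i ⊕ K ⊕ L ⊜ (A ⊕ c ⊕ i ⊕ K) ⊕ B ⊕ L) ≋-refl

    expose-server : ∀ N o s m L → N ++ (o ++ s) ++ m ++ L ≋ s ++ o ++ m ++ N ++ L
    expose-server = solve 5 (λ N o s m L → N ⊕ (o ⊕ s) ⊕ m ⊕ L ⊜ s ⊕ o ⊕ m ⊕ N ⊕ L) ≋-refl

    expose-copy : ∀ o r w s m N L → o ++ r ++ w ++ s ++ m ++ N ++ L ≋ N ++ (r ++ w) ++ m ++ (o ++ s) ++ L
    expose-copy = solve 7 (λ o r w s m N L →
      o ⊕ r ⊕ w ⊕ s ⊕ m ⊕ N ⊕ L ⊜ N ⊕ (r ⊕ w) ⊕ m ⊕ (o ⊕ s) ⊕ L) ≋-refl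

Answers : (ns : List ℕ) (L M : Bag) → WProc 0 → Name → Thunk (_∈ ns) → Set
Answers ns L M W v t = ∃₂ λ W' k' → ∃₂ λ ns' L' → ∃ λ M' →
  τ⇒ AWπ W W' × Alive (W⟪ W' ⟫ ∅) k' (managers ns' ++ L') × Flat° (bodyA t (v ∷ [])) M' ×
  Settled (_∈ ns') L' (M' ++ M)

opaque
  -- Serves single inputs and unfolded copies alike, as both appear as a request with a waiting
  -- prefix. The continuation may create channels, hence the enlarged list of managers.
  answer : ∀ {ns W k n v z K L M} {t : Thunk (_∈ ns)} → n ∈ ns → Good v → Alive (W⟪ W ⟫ ∅) k K →
           K ≋ managers ns ++ (requestA n z ∷ waitA n z t ∷ []) ++ messageA n v ∷ L →
           Settled (_∈ ns) L M → Answers ns L M W v t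
  answer {ns} {W} {n = n} {v} {z} {J} {L} {M} {t} n∈ gv fW e s =
    let K , e' = managers-∈ n∈
        arrange : J ≋ messageA n v ∷ managerA n ∷ idleA n ∷ requestA n z ∷ waitA n z t ∷ K ++ L
        arrange = ≋-trans e (≋-trans (B.++⁺ʳ ((requestA n z ∷ waitA n z t ∷ []) ++ messageA n v ∷ L) e')
          (expose [ managerA n ] [ idleA n ] [ requestA n z ] [ waitA n z t ] [ messageA n v ] K L))
        W' , k' , _ , fl , st , fW' = communicate {t = t} gv fW arrange
    in finish K e' fl st fW'
    where
    finish : ∀ {W' k' k₁} K → managers ns ≋ managerA n ∷ idleA n ∷ K →
             (fl : Flattening (_∈ ns) (Thunk.B t) (v ▸ Thunk.σ t) (v ▸ Thunk.F t) k₁) → τ⇒ AWπ W W' →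
             Alive (W⟪ W' ⟫ ∅) k' ((managers (Flattening.ns fl) ++ Flattening.L fl) ++ managerA n ∷ idleA n ∷ K ++ L) →
             Answers ns L M W v t
    finish {W'} {k'} K e' (mkFlattening ns' {L'} {M'} _ _ _ flA s') st fW' =
      W' , k' , ns' ++ ns , L' ++ L , M' , st ,
      alive-≋ (≋-trans (collect (managers ns') L' [ managerA n ] [ idleA n ] K L)
        (B.++⁺ʳ (L' ++ L) (≋-trans (B.++⁺ˡ (managers ns') (≋-sym e'))
          (SPerm.↭-reflexive atomSetoid (sym (managers-++ ns' ns)))))) fW' ,
      flat° flA ,
      settled-++ (settled-map [ ∈-++⁺ˡ , ∈-++⁺ʳ ns' ]′ s') (settled-map (∈-++⁺ʳ ns') s)

reply : ∀ {ns W k g a f v K K' x y L M} → Source (_∈ ns) K x → x ≈ₐ preA g a 1 f →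
        Source (_∈ ns) K' y → y ≈ₐ sendA a (v ∷ []) → Alive (W⟪ W ⟫ ∅) k (managers ns ++ K ++ K' ++ L) →
        Settled (_∈ ns) L M →
        ∃₂ λ W' k' → ∃₂ λ ns' L' → ∃₂ λ M' N →
          τ⇒ AWπ W W' × Alive (W⟪ W' ⟫ ∅) k' (managers ns' ++ L') × Flat° (f (v ∷ [])) M' ×
          Settled (_∈ ns') L' (M' ++ N) × N ≋ left g a 1 f ++ M
reply (input n∈ z t) (pre≈ₐ b≈) (output _ gv) send≈ₐ fW s
  with answer {z = z} {t = t} n∈ gv fW ≋-refl s
... | W' , k' , ns' , L' , M' , sts , fW' , fM , s' =
  W' , k' , ns' , L' , M' , _ , sts , fW' , flat°-≈ (b≈ _) fM , s' , ≋-refl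
reply {ns} {L = L} (server {n} n∈ d t) (pre≈ₐ b≈) (output {v = v} _ gv) send≈ₐ fW s
  with spawn {t = t} fW (expose-server (managers ns) [ tokenA d ] [ serverA d n t ] [ messageA n v ] L)
... | W₁ , _ , z , st₁ , fW₁
  with answer {z = z} {t = t} n∈ gv fW₁
         (expose-copy [ tokenA d ] [ requestA n z ] [ waitA n z t ] [ serverA d n t ] [ messageA n v ]
           (managers ns) L)
         -- Server and token survive the unfolding and belong to the remainder; in ALπ they match
         -- the replicated input that stays behind.
         (server n∈ d t s)
... | W' , k' , ns' , L' , M' , sts , fW' , fM , s' =
  W' , k' , ns' , L' , M' , _ , st₁ ◅ sts , fW' , flat°-≈ (b≈ _) fM , s' ,
  ≋-cons (pre≈ₐ b≈) ≋-refl

encoded-τ : ∀ {P P' W} → Encoded P W → Step P τ P' → ∃ λ W' → τ⇒ AWπ W W' × Encoded P' W'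
encoded-τ {W = W} (mkEncoded {ns = ns} fA fW s) st with step-τ st fA
... | mkTau g f rest eq next with pick-≋ eq
... | x , M₁ , p₁ , e₁ , r₁ with pick-≋ r₁
... | y , M₂ , p₂ , e₂ , r₂ with settled-pick s p₁
... | K , L₁ , src , s₁ , t₁ with settled-pick s₁ p₂
... | K' , L₂ , src' , s₂ , t₂
  with reply src e₁ src' e₂ (alive-≋ (B.++⁺ˡ (managers ns) (≋-trans t₁ (B.++⁺ˡ K t₂))) fW) s₂
... | W' , _ , _ , _ , M' , _ , sts , fW' , fM , s' , r = W' , sts ,
  mkEncoded (flat°-≋ (B.++⁺ˡ M' (≋-sym (≋-trans r (B.++⁺ˡ (left g _ 1 f) r₂)))) (next fM)) fW' s'

encoded-ω : ∀ {P P' W w} → Encoded P W → Step P (outA (sn w) ⋆) P' → ∃ λ W' → WOut w W W' × Encoded P' W'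
encoded-ω (mkEncoded {ns = ns} fA fW s) st with step-out st fA
... | M₀ , r , fA' with pick-≋ r
... | y , M₁ , p , send≈ₐ , e with settled-pick s p
... | _ , L₁ , output _ _ , s₁ , t
  with W-success fW (≋-trans (B.++⁺ˡ (managers ns) t) (B.↭-shift (managers ns) L₁))
... | W' , st' , fW' = W' , st' , mkEncoded (flat°-≋ (≋-sym e) fA') fW' s₁

encoding-simulates : ∀ P → [] ⊢ P → WeaklySimulates ALπ AWπ P ⟦ P ⟧∅
encoding-simulates P ty = Encoded , sim , init
  where
  sim : IsWeakSim ALπ AWπ Encoded
  sim τo s st = encoded-τ s st
  sim (ωo w) s st with encoded-ω s st
  ... | W' , st' , s' = W' , (_ , _ , ε , st' , ε) , s'
  init : Encoded P ⟦ P ⟧∅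
  -- With no channels given from outside, every channel referred to has its manager among those
  -- listed in `ns`.
  init with flatten-closed {λ _ → ⊥} ty
  ... | mkFlattening ns al _ flE flA set =
    mkEncoded (flat° flA) (alive (Alloc.unique al) (alloc⇒below al) (flat-~ (~-sym (enc∅~ P)) flE))
      (settled-map [ id , ⊥-elim ]′ set)

theorem6p2 : (P : Proc 0) → [] ⊢ P → WeakSimEquiv AWπ ALπ ⟦ P ⟧∅ P
theorem6p2 P ty = encoding-simulated P ty , encoding-simulates P ty
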